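{- Let $n\geq 2$ and $j\geq 2$ be integers. If $j$ is even, then \[ m_j(K_j,K_{1,n})=\Big\lfloor \frac{2(n-1)(j-1)}{j}\Big\rfloor+1 . \] If $j$ is odd, then \[ m_j(K_j,K_{1,n})=\Big\lfloor \frac{2(n-1)(j-2)}{j-1}\Big\rfloor+1 . \]
   Context: All graphs are simple; $K_j$ is the complete graph on $j$ vertices and $K_{1,n}$ is the star with $n+1$ vertices ($n$ leaves). For integers $j\geq 2$ and $t\geq 1$, $K_{j\times t}$ denotes the complete multipartite graph with $j$ parts, each of size $t$. For graphs $H$ and $G$, the size multipartite Ramsey number $m_j(H,G)$ is the smallest natural number $t$ such that every coloring of the edges of $K_{j\times t}$ with two colors red and blue contains a red copy of $H$ or a blue copy of $G$ as a subgraph. -}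

module Defs where
open import Data.Nat using (ℕ; zero; suc; _<_; _/_)
open import Data.Fin using (Fin)
open import Data.Product using (Σ; _×_; _,_; proj₁)
open import Relation.Binary.PropositionalEquality using (_≡_; _≢_)
open import Relation.Nullary using (¬_)
open import Function.Definitions using (Injective)
open import Data.Sum using (_⊎_)

data Colour : Set where
  red blue : Colour

-- Vertices of the complete multipartite graph K_{j×t}:
-- a vertex is (part index, index within the part).
Vertex : ℕ → ℕ → Set
Vertex j t = Fin j × Fin t

Adj : ∀ {j t} → Vertex j t → Vertex j t → Set
Adj u v = proj₁ u ≢ proj₁ v

-- A 2-colouring of the edges of K_{j×t}: a symmetric colour function on pairs of
-- vertices (its values on non-adjacent pairs are irrelevant).
record Colouring (j t : ℕ) : Set where
  field
    col : Vertex j t → Vertex j t → Colour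
    sym : ∀ u v → col u v ≡ col v u
open Colouring public

RedClique : ∀ {j t} → Colouring j t → ℕ → Set
RedClique {j} {t} c m =
  Σ (Fin m → Vertex j t) λ f →
    Injective _≡_ _≡_ f ×
    (∀ a b → a ≢ b → Adj (f a) (f b) × col c (f a) (f b) ≡ red)

-- A blue copy of the star K_{1,n}: a centre v and n distinct leaves, each adjacent
-- to v via a blue edge (adjacency forces leaves ≠ centre).
BlueStar : ∀ {j t} → Colouring j t → ℕ → Set
BlueStar {j} {t} c n =
  Σ (Vertex j t) λ v →
    Σ (Fin n → Vertex j t) λ g →
      Injective _≡_ _≡_ g ×
      (∀ a → Adj v (g a) × col c v (g a) ≡ blue)

Arrows : ℕ → ℕ → ℕ → Set
Arrows j n t = (c : Colouring j t) → RedClique c j ⊎ BlueStar c n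

IsSizeMRN : ℕ → ℕ → ℕ → Set
IsSizeMRN j n s = Arrows j n s × (∀ t → t < s → ¬ Arrows j n t)

-- Floor division ⌊a/d⌋ (only ever used with d ≥ 1; the value at d = 0 is a dummy 0).
⌊_/_⌋ : ℕ → ℕ → ℕ
⌊ a / zero ⌋ = zero
⌊ a / suc d ⌋ = a / suc d

{-# OPTIONS --safe #-}
module Submission where

-- An independent transversal of the blue graph is a red K_j, so the question is which part size
-- t forces one when blue degrees are at most Δ = n - 1. Write s = 2Δ - t.
--
-- Upper bound. Haxell's argument: if there is no independent transversal, some set S of parts is
-- dominated by a set Z of at most 2(|S| - 1) vertices, and either |Z| ≤ 2|S| - 3 or Z contains an
-- independent transversal of S minus any one part ("swappable"). Counting degrees gives
-- 2Δ ≤ |S|s, which settles even j. For j = 2h + 1 suppose hs < Δ. A configuration is a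
-- swappable pair (C , W) with a vertex x outside C not adjacent to W; its leak is the number of
-- edges from W and x to vertices outside C. Since |C| ≤ h parts are too many to be dominated by
-- 2|C| - 1 vertices, C has a vertex y not adjacent to x and W. Then W, x, y contain an
-- independent transversal of C and the part of x, and Haxell's argument on the other parts,
-- restricted to vertices not adjacent to W, x, y, gives a new configuration (S , Z) with y,
-- whose leak changes by |S|s - Δ. Passing back to at most h parts when |S| > h, one obtains
-- an infinite sequence of configurations with |C| ≤ h and leak less than s, in which |C| never
-- decreases and the leak decreases whenever |C| does not grow.
--
-- Lower bound. A binary hierarchy of complete bipartite graphs K_{Δ,Δ} whose top level splits
-- 2h parts into two halves.

open import Defs hiding (sym)
open import Data.Bool using (Bool; true; false; not; _∧_; _∨_)
import Data.Bool as Bool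
open import Data.Bool.Properties using (¬-not; not-injective)
open import Data.Empty using (⊥; ⊥-elim)
open import Data.Fin using (Fin; toℕ; inject≤; fromℕ<; punchOut)
import Data.Fin as Fin
open import Data.Fin.Properties using (any?; all?; inject≤-injective; toℕ<n; toℕ-injective; toℕ-fromℕ<; fromℕ<-injective; pigeonhole; punchOut-injective; <⇒notInjective)
open import Data.List using (List; []; _∷_; _++_; map; length; filter; allFin; cartesianProduct; lookup)
open import Data.List.Membership.Propositional using (_∈_)
open import Data.List.Membership.Propositional.Properties using (∈-++⁺ˡ; ∈-++⁺ʳ; ∈-++⁻; ∈-map⁺; ∈-map⁻; ∈-filter⁺; ∈-filter⁻; ∈-allFin; ∈-lookup)
open import Data.List.Properties using (length-++; length-map; map-++; length-tabulate)
import Data.List.Relation.Unary.All as All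
open import Data.List.Relation.Unary.Any using (here; there)
open import Data.List.Relation.Unary.Unique.Propositional using (Unique; []; _∷_)
open import Data.List.Relation.Unary.Unique.Propositional.Properties using (filter⁺; cartesianProduct⁺; allFin⁺)
open import Data.Maybe using (Maybe; just; nothing)
import Data.Maybe as Maybe
open import Data.Maybe.Properties using (just-injective)
import Data.Maybe.Properties as Maybe
open import Data.Nat using (ℕ; zero; suc; _+_; _*_; _∸_; _⊓_; _≤_; _<_; z≤n; s≤s; NonZero; >-nonZero; _/_; _%_)
import Data.Nat as ℕ
open import Data.Nat.Divisibility using (_∣_; divides; m%n≡0⇒n∣m)
open import Data.Nat.DivMod using (m/n*n≤m; m≡m%n+[m/n]*n; m%n<n; m<n*o⇒m/o<n)
open import Data.Nat.ListAction using (sum)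
open import Data.Nat.ListAction.Properties using (sum-++)
open import Data.Nat.Properties
open import Data.Nat.Tactic.RingSolver using (solve-∀)
open import Data.Product using (∃; _×_; _,_; proj₁; proj₂)
import Data.Product.Properties as Product
open import Data.Sum using (_⊎_; inj₁; inj₂)
open import Data.Unit using (⊤; tt)
open import Data.Vec using (Vec; []; _∷_)
import Data.Vec as Vec
import Data.Vec.Properties as Vec
open import Function using (_∘_; case_of_; id)
open import Function.Definitions using (Injective)
open import Relation.Binary.PropositionalEquality hiding (J)
open import Relation.Nullary using (¬_; Dec; yes; no; does; contradiction)
open import Relation.Nullary.Decidable using (map′)

-- A ≤ B is meant to be the sum of the hypotheses from which X ≤ Y follows with slack k.
linear : ∀ {A B X Y} k → A ≤ B → k + X + B ≡ Y + A → X ≤ Y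
linear {A} {B} {X} {Y} k A≤B eq = +-cancelʳ-≤ A X Y (begin
  X + A       ≤⟨ +-monoʳ-≤ X A≤B ⟩
  X + B       ≤⟨ m≤n+m (X + B) k ⟩
  k + (X + B) ≡⟨ +-assoc k X B ⟨
  k + X + B   ≡⟨ eq ⟩
  Y + A       ∎)
  where open ≤-Reasoning

¬¬-em : {P : Set} → ¬ ¬ (P ⊎ ¬ P)
¬¬-em f = f (inj₂ (f ∘ inj₁))

-- Sums and sizes

𝟙 : Bool → ℕ
𝟙 true  = 1
𝟙 false = 0

𝟙-mono : ∀ {b c} → (b ≡ true → c ≡ true) → 𝟙 b ≤ 𝟙 c
𝟙-mono {false} _ = z≤n
𝟙-mono {true}  b⇒c rewrite b⇒c refl = ≤-refl

true≢false : ∀ {b} → b ≡ true → b ≢ false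
true≢false refl ()

module _ {A : Set} where

  total : List A → (A → ℕ) → ℕ
  total xs f = sum (map f xs)

  total-+ : ∀ (f g : A → ℕ) xs → total xs (λ x → f x + g x) ≡ total xs f + total xs g
  total-+ f g []       = refl
  total-+ f g (x ∷ xs) rewrite total-+ f g xs = interchange (f x) (g x) (total xs f) (total xs g)
    where
    interchange : ∀ a b c d → a + b + (c + d) ≡ a + c + (b + d)
    interchange = solve-∀

  total-mono : ∀ {f g : A → ℕ} xs → (∀ x → f x ≤ g x) → total xs f ≤ total xs g
  total-mono []       f≤g = z≤n
  total-mono (x ∷ xs) f≤g = +-mono-≤ (f≤g x) (total-mono xs f≤g)

  total-cong : ∀ {f g : A → ℕ} xs → (∀ x → f x ≡ g x) → total xs f ≡ total xs g
  total-cong xs f≡g = ≤-antisym (total-mono xs (≤-reflexive ∘ f≡g)) (total-mono xs (≤-reflexive ∘ sym ∘ f≡g))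

  total-mono-< : ∀ {f g : A → ℕ} {xs y} → (∀ x → f x ≤ g x) → y ∈ xs → f y < g y → total xs f < total xs g
  total-mono-< {xs = _ ∷ xs} f≤g (here refl) fy<gy = +-mono-<-≤ fy<gy (total-mono xs f≤g)
  total-mono-< {xs = x ∷ _}  f≤g (there y∈)  fy<gy = +-mono-≤-< (f≤g x) (total-mono-< f≤g y∈ fy<gy)

  term≤total : ∀ (f : A → ℕ) {xs y} → y ∈ xs → f y ≤ total xs f
  term≤total f {_ ∷ xs} (here refl) = m≤m+n _ _
  term≤total f {x ∷ _}  (there y∈)  = ≤-trans (term≤total f y∈) (m≤n+m _ _)

  total-++ : ∀ (f : A → ℕ) xs ys → total (xs ++ ys) f ≡ total xs f + total ys f
  total-++ f xs ys = trans (cong sum (map-++ f xs ys)) (sum-++ (map f xs) (map f ys))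

  length-filter : ∀ (b : A → Bool) xs → length (filter (λ x → b x Bool.≟ true) xs) ≡ total xs (𝟙 ∘ b)
  length-filter b []       = refl
  length-filter b (x ∷ xs) with b x
  ... | true  = cong suc (length-filter b xs)
  ... | false = length-filter b xs

-- Independent transversals of labelled graphs

module Transversals (r : ℕ) {V : Set} (e : V → V → Bool)
                    (e-sym : ∀ u v → e u v ≡ e v u) (e-irrefl : ∀ v → e v v ≡ false) where

  LabelSet : Set
  LabelSet = Fin r → Bool

  size : LabelSet → ℕ
  size S = total (allFin r) (𝟙 ∘ S)

  infixl 6 _∖_ _⊎ₗ_

  abstract

    _∖_ : LabelSet → Fin r → LabelSet
    (S ∖ k) l with l Fin.≟ k
    ... | yes _ = false
    ... | no  _ = S l

    ∖⁺ : ∀ S {k l} → S l ≡ true → l ≢ k → (S ∖ k) l ≡ true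
    ∖⁺ S {k} {l} Sl l≢k with l Fin.≟ k
    ... | yes l≡k = contradiction l≡k l≢k
    ... | no  _   = Sl

    ∖⁻ : ∀ S {k l} → (S ∖ k) l ≡ true → S l ≡ true × l ≢ k
    ∖⁻ S {k} {l} Sl with l Fin.≟ k
    ... | no l≢k = Sl , l≢k

    ⁅_⁆ : Fin r → LabelSet
    ⁅ k ⁆ l = does (l Fin.≟ k)

    ⁅⁆⁺ : ∀ k → ⁅ k ⁆ k ≡ true
    ⁅⁆⁺ k with k Fin.≟ k
    ... | yes _   = refl
    ... | no  k≢k = contradiction refl k≢k

    ⁅⁆⁻ : ∀ {k l} → ⁅ k ⁆ l ≡ true → l ≡ k
    ⁅⁆⁻ {k} {l} eq with l Fin.≟ k
    ... | yes l≡k = l≡k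

    _⊎ₗ_ : LabelSet → LabelSet → LabelSet
    (S ⊎ₗ J) l = S l ∨ J l

    ⊎ₗ⁻ : ∀ S J {l} → (S ⊎ₗ J) l ≡ true → S l ≡ true ⊎ (S l ≡ false × J l ≡ true)
    ⊎ₗ⁻ S J {l} eq with S l
    ... | true  = inj₁ refl
    ... | false = inj₂ (refl , eq)

    ⊎ₗ⁺ˡ : ∀ S J {l} → S l ≡ true → (S ⊎ₗ J) l ≡ true
    ⊎ₗ⁺ˡ S J {l} eq rewrite eq = refl

    size-⊎ₗ : ∀ S J → (∀ k → S k ≡ true → J k ≡ false) → size (S ⊎ₗ J) ≡ size S + size J
    size-⊎ₗ S J disj = trans (total-cong (allFin r) pointwise) (total-+ (𝟙 ∘ S) (𝟙 ∘ J) (allFin r))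
      where
      pointwise : ∀ k → 𝟙 (S k ∨ J k) ≡ 𝟙 (S k) + 𝟙 (J k)
      pointwise k with S k | disj k
      ... | true  | d rewrite d refl = refl
      ... | false | _ = refl

  size-mono-< : ∀ S J k → (∀ l → S l ≡ true → J l ≡ true) → S k ≡ false → J k ≡ true → size S < size J
  size-mono-< S J k S⊆J ¬Sk Jk = total-mono-< (λ l → 𝟙-mono (S⊆J l)) (∈-allFin k) lt
    where
    lt : 𝟙 (S k) < 𝟙 (J k)
    lt rewrite ¬Sk | Jk = s≤s z≤n

  0<size : ∀ S k → S k ≡ true → 0 < size S
  0<size S k Sk = ≤-trans (≤-reflexive (sym (cong 𝟙 Sk))) (term≤total (𝟙 ∘ S) (∈-allFin k))

  size-∖ : ∀ S k → S k ≡ true → size (S ∖ k) < size S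
  size-∖ S k Sk = size-mono-< (S ∖ k) S k (λ l → proj₁ ∘ ∖⁻ S) (¬-not (λ eq → proj₂ (∖⁻ S {k} {k} eq) refl)) Sk

  size-unique : ∀ S k l → size S ≤ 1 → S k ≡ true → S l ≡ true → k ≡ l
  size-unique S k l S≤1 Sk Sl with k Fin.≟ l
  ... | yes k≡l = k≡l
  ... | no  k≢l = contradiction S≤1 (<⇒≱ (≤-trans (s≤s (0<size (S ∖ l) k (∖⁺ S Sk k≢l))) (size-∖ S l Sl)))

  degree : List V → V → ℕ
  degree Z v = total Z (λ w → 𝟙 (e w v))

  degree≡0⇒e : ∀ {Z v w} → degree Z v ≡ 0 → w ∈ Z → e w v ≡ false
  degree≡0⇒e {Z} {v} {w} eq w∈Z with e w v in ewv
  ... | false = refl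
  ... | true  = contradiction (≤-trans (≤-reflexive (sym (cong 𝟙 ewv))) (≤-trans (term≤total (λ u → 𝟙 (e u v)) w∈Z) (≤-reflexive eq))) λ()

  e⇒degree≡0 : ∀ {Z v} → (∀ w → w ∈ Z → e w v ≡ false) → degree Z v ≡ 0
  e⇒degree≡0 {[]}    non = refl
  e⇒degree≡0 {z ∷ Z} non rewrite non z (here refl) = e⇒degree≡0 {Z} (λ w → non w ∘ there)

  e-flip : ∀ {u v} → e u v ≡ false → e v u ≡ false
  e-flip {u} {v} = trans (e-sym v u)

  -- The labelling `p` is a parameter because labels get merged during the induction, and `X`
  -- because vertices get deleted. `rep` is a total function with arbitrary values outside `R`.
  record Transversal (p : V → Fin r) (R : LabelSet) (X : V → Set) : Set where
    field
      rep         : Fin r → V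
      rep-label   : ∀ k → R k ≡ true → p (rep k) ≡ k
      rep-in      : ∀ k → R k ≡ true → X (rep k)
      independent : ∀ k l → R k ≡ true → R l ≡ true → e (rep k) (rep l) ≡ false
  open Transversal public

  Swappable : (V → Fin r) → LabelSet → List V → Set
  Swappable p S Z = ∀ k → S k ≡ true → Transversal p (S ∖ k) (_∈ Z)

  -- The output of Haxell's argument. Additions replace the subtractions in 2|S| - 3 and 2|S| - 2,
  -- so nothing is truncated. The root `i` may stand for several merged labels; keeping it in `S`
  -- lets these be restored afterwards.
  record Domination (p : V → Fin r) (R : LabelSet) (X : V → Set) (i : Fin r) : Set where
    field
      S      : LabelSet
      S⊆R    : ∀ k → S k ≡ true → R k ≡ true
      root   : S i ≡ true
      Z      : List V
      Z⊆X    : ∀ z → z ∈ Z → X z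
      dom    : ∀ v → X v → S (p v) ≡ true → 1 ≤ degree Z v
      shape  : (length Z + 3 ≤ 2 * size S) ⊎ (length Z + 2 ≤ 2 * size S × Swappable p S Z)

  -- One step of the induction: the vertex a with label i and its neighbours I k (k ∈ J) in the
  -- partial transversal I are removed together with all their neighbours, and the labels J are
  -- merged into i.
  module Explosion (p : V → Fin r) (R : LabelSet) (X : V → Set) (i : Fin r)
                   (i∈R : R i ≡ true) (a : V) (pa : p a ≡ i) (a∈X : X a)
                   (τ : Transversal p (R ∖ i) X) (noT : ¬ Transversal p R X) where

    I : Fin r → V
    I = rep τ

    J : LabelSet
    J k = (R ∖ i) k ∧ e a (I k)

    J⁻ : ∀ {k} → J k ≡ true → (R ∖ i) k ≡ true × e a (I k) ≡ true
    J⁻ {k} eq with (R ∖ i) k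
    ... | true = refl , eq

    J⇒R : ∀ {k} → J k ≡ true → R k ≡ true
    J⇒R = proj₁ ∘ ∖⁻ R ∘ proj₁ ∘ J⁻

    J⇒≢i : ∀ {k} → J k ≡ true → k ≢ i
    J⇒≢i = proj₂ ∘ ∖⁻ R ∘ proj₁ ∘ J⁻

    i∉J : J i ≡ false
    i∉J = ¬-not (λ Ji → J⇒≢i Ji refl)

    ¬J⇒e : ∀ {k} → (R ∖ i) k ≡ true → J k ≡ false → e a (I k) ≡ false
    ¬J⇒e {k} Rk ¬Jk rewrite Rk = ¬Jk

    star : List V
    star = a ∷ map I (filter (λ k → J k Bool.≟ true) (allFin r))

    length-star : length star ≡ suc (size J)
    length-star = cong suc (trans (length-map I (filter (λ k → J k Bool.≟ true) (allFin r))) (length-filter J (allFin r)))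

    I∈star : ∀ {k} → J k ≡ true → I k ∈ star
    I∈star {k} Jk = there (∈-map⁺ I (∈-filter⁺ (λ k → J k Bool.≟ true) (∈-allFin k) Jk))

    star⁻ : ∀ {v} → v ∈ star → v ≡ a ⊎ ∃ λ k → J k ≡ true × v ≡ I k
    star⁻ (here refl) = inj₁ refl
    star⁻ (there v∈) with ∈-map⁻ I v∈
    ... | k , k∈ , eq = inj₂ (k , proj₂ (∈-filter⁻ (λ k → J k Bool.≟ true) {xs = allFin r} k∈) , eq)

    p′ : V → Fin r
    p′ v with J (p v)
    ... | true  = i
    ... | false = p v

    p′≡⇒p≡ : ∀ {v k} → p′ v ≡ k → k ≢ i → p v ≡ k
    p′≡⇒p≡ {v} eq k≢i with J (p v)
    ... | true  = contradiction (sym eq) k≢i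
    ... | false = eq

    p′≡i : ∀ {v} → p′ v ≡ i → p v ≡ i ⊎ J (p v) ≡ true
    p′≡i {v} eq with J (p v)
    ... | true  = inj₂ refl
    ... | false = inj₁ eq

    p≡⇒p′≡ : ∀ {v k} → p v ≡ k → J k ≡ false → p′ v ≡ k
    p≡⇒p′≡ {v} refl ¬Jk with J (p v)
    ... | false = refl

    R′ : LabelSet
    R′ k = R k ∧ not (J k)

    R′⁺ : ∀ {k} → R k ≡ true → J k ≡ false → R′ k ≡ true
    R′⁺ Rk ¬Jk rewrite Rk | ¬Jk = refl

    R′⁻ : ∀ {k} → R′ k ≡ true → R k ≡ true × J k ≡ false
    R′⁻ {k} eq with R k | J k
    ... | true | false = refl , refl

    X′ : V → Set
    X′ v = X v × degree star v ≡ 0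

    X′⇒a : ∀ {v} → X′ v → e a v ≡ false
    X′⇒a (_ , d) = degree≡0⇒e {star} d (here refl)

    X′⇒I : ∀ {v k} → X′ v → J k ≡ true → e (I k) v ≡ false
    X′⇒I (_ , d) Jk = degree≡0⇒e {star} d (I∈star Jk)

    I-indep : ∀ {k l} → J k ≡ true → J l ≡ true → e (I k) (I l) ≡ false
    I-indep Jk Jl = independent τ _ _ (proj₁ (J⁻ Jk)) (proj₁ (J⁻ Jl))

    merging-shrinks : ∀ {k} → J k ≡ true → size R′ < size R
    merging-shrinks {k} Jk = size-mono-< R′ R k (λ l → proj₁ ∘ R′⁻) (¬-not (λ R′k → true≢false Jk (proj₂ (R′⁻ R′k)))) (J⇒R Jk)

    -- The part of `I` off `J` survives the deletion: it avoids the neighbours of `a` by the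
    -- definition of `J`, and those of the other star vertices by independence of `τ`.
    τ′ : Transversal p′ (R′ ∖ i) X′
    τ′ .rep = I
    τ′ .rep-label k k∈ with ∖⁻ R′ k∈
    ... | R′k , k≢i with R′⁻ R′k
    ...   | Rk , ¬Jk = p≡⇒p′≡ (rep-label τ k (∖⁺ R Rk k≢i)) ¬Jk
    τ′ .rep-in k k∈ with ∖⁻ R′ k∈
    ... | R′k , k≢i with R′⁻ R′k
    ...   | Rk , ¬Jk = rep-in τ k Rk∖ , e⇒degree≡0 {star} non
      where
      Rk∖ : (R ∖ i) k ≡ true
      Rk∖ = ∖⁺ R Rk k≢i
      non : ∀ w → w ∈ star → e w (I k) ≡ false
      non w w∈ with star⁻ w∈
      ... | inj₁ refl = ¬J⇒e Rk∖ ¬Jk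
      ... | inj₂ (l , Jl , refl) = independent τ l k (proj₁ (J⁻ Jl)) Rk∖
    τ′ .independent k l k∈ l∈ = independent τ k l (conv k∈) (conv l∈)
      where
      conv : ∀ {k} → (R′ ∖ i) k ≡ true → (R ∖ i) k ≡ true
      conv k∈ = let R′k , k≢i = ∖⁻ R′ k∈ in ∖⁺ R (proj₁ (R′⁻ R′k)) k≢i

    -- Otherwise `a` would complete the partial transversal `I`.
    has-neighbour : ¬ (∀ k → J k ≡ false)
    has-neighbour ¬J = noT record { rep = g ; rep-label = g-label ; rep-in = g-in ; independent = g-ind }
      where
      g : Fin r → V
      g k with k Fin.≟ i
      ... | yes _ = a
      ... | no  _ = I k
      g-label : ∀ k → R k ≡ true → p (g k) ≡ k
      g-label k Rk with k Fin.≟ i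
      ... | yes refl = pa
      ... | no  k≢i  = rep-label τ k (∖⁺ R Rk k≢i)
      g-in : ∀ k → R k ≡ true → X (g k)
      g-in k Rk with k Fin.≟ i
      ... | yes refl = a∈X
      ... | no  k≢i  = rep-in τ k (∖⁺ R Rk k≢i)
      g-ind : ∀ k l → R k ≡ true → R l ≡ true → e (g k) (g l) ≡ false
      g-ind k l Rk Rl with k Fin.≟ i | l Fin.≟ i
      ... | yes _ | yes _ = e-irrefl a
      ... | yes _ | no l≢i = ¬J⇒e (∖⁺ R Rl l≢i) (¬J l)
      ... | no k≢i | yes _ = e-flip (¬J⇒e (∖⁺ R Rk k≢i) (¬J k))
      ... | no k≢i | no l≢i = independent τ k l (∖⁺ R Rk k≢i) (∖⁺ R Rl l≢i)

    module _ (γ : Transversal p′ R′ X′) where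

      private
        g : Fin r → V
        g = rep γ
        i∈R′ : R′ i ≡ true
        i∈R′ = R′⁺ i∈R i∉J
        merged : Fin r → V
        merged k with J k
        ... | true  = I k
        ... | false = g k
        merged-in : ∀ k → R k ≡ true → X (merged k)
        merged-in k Rk with J k in Jk
        ... | true  = rep-in τ k (proj₁ (J⁻ Jk))
        ... | false = proj₁ (rep-in γ k (R′⁺ Rk Jk))
        merged-label : ∀ k → R k ≡ true → k ≢ i → p (merged k) ≡ k
        merged-label k Rk k≢i with J k in Jk
        ... | true  = rep-label τ k (proj₁ (J⁻ Jk))
        ... | false = p′≡⇒p≡ (rep-label γ k (R′⁺ Rk Jk)) k≢i
        merged-ind : ∀ k l → R k ≡ true → R l ≡ true → e (merged k) (merged l) ≡ false
        merged-ind k l Rk Rl with J k in Jk | J l in Jl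
        ... | true  | true  = I-indep Jk Jl
        ... | true  | false = X′⇒I (rep-in γ l (R′⁺ Rl Jl)) Jk
        ... | false | true  = e-flip (X′⇒I (rep-in γ k (R′⁺ Rk Jk)) Jl)
        ... | false | false = independent γ k l (R′⁺ Rk Jk) (R′⁺ Rl Jl)
        merged-g : ∀ k → R k ≡ true → e (g i) (merged k) ≡ false
        merged-g k Rk with J k in Jk
        ... | true  = e-flip (X′⇒I (rep-in γ i i∈R′) Jk)
        ... | false = independent γ i k i∈R′ (R′⁺ Rk Jk)
        merged-a : ∀ k → R k ≡ true → J k ≡ false → e a (merged k) ≡ false
        merged-a k Rk ¬Jk with J k in Jk
        ... | false = X′⇒a (rep-in γ k (R′⁺ Rk Jk))

      -- Were this representative in class `i`, the vertices `I k` with `k` in `J` could be added to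
      -- `γ`, none of whose vertices is adjacent to the star, and all of `R` would be represented.
      unmerged-root : p (g i) ≢ i
      unmerged-root pgi = noT record
        { rep = merged ; rep-label = label ; rep-in = merged-in ; independent = merged-ind }
        where
        label : ∀ k → R k ≡ true → p (merged k) ≡ k
        label k Rk = by-cases (k Fin.≟ i)
          where
          by-cases : Dec (k ≡ i) → p (merged k) ≡ k
          by-cases (no  k≢i)  = merged-label k Rk k≢i
          by-cases (yes refl) rewrite i∉J = pgi

      -- If the representative of the merged label lies in a class k₀ ∈ J, it can replace I k₀,
      -- after which a has one neighbour less in the partial transversal.
      module Swap (k₀∈J : J (p (g i)) ≡ true) where

        private
          k₀ : Fin r
          k₀ = p (g i)
          swap : Fin r → V
          swap k with k Fin.≟ k₀
          ... | yes _ = g i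
          ... | no  _ = merged k

        swapped : Transversal p (R ∖ i) X
        swapped .rep = swap
        swapped .rep-label k k∈ with k Fin.≟ k₀
        ... | yes k≡k₀ = sym k≡k₀
        ... | no  _    = let Rk , k≢i = ∖⁻ R k∈ in merged-label k Rk k≢i
        swapped .rep-in k k∈ with k Fin.≟ k₀
        ... | yes _ = proj₁ (rep-in γ i i∈R′)
        ... | no  _ = merged-in k (proj₁ (∖⁻ R k∈))
        swapped .independent k l k∈ l∈ with k Fin.≟ k₀ | l Fin.≟ k₀
        ... | yes _ | yes _ = e-irrefl (g i)
        ... | yes _ | no  _ = merged-g l (proj₁ (∖⁻ R l∈))
        ... | no  _ | yes _ = e-flip (merged-g k (proj₁ (∖⁻ R k∈)))
        ... | no  _ | no  _ = merged-ind k l (proj₁ (∖⁻ R k∈)) (proj₁ (∖⁻ R l∈))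

        fewer : size (λ k → (R ∖ i) k ∧ e a (swap k)) < size J
        fewer = size-mono-< _ J k₀ sub ¬k₀ k₀∈J
          where
          a-swap : ∀ k → (R ∖ i) k ≡ true → (J k ≡ false ⊎ k ≡ k₀) → e a (swap k) ≡ false
          a-swap k k∈ alt with k Fin.≟ k₀ | alt
          ... | yes _   | _        = X′⇒a (rep-in γ i i∈R′)
          ... | no  k≢  | inj₂ k≡  = contradiction k≡ k≢
          ... | no  _   | inj₁ ¬Jk = merged-a k (proj₁ (∖⁻ R k∈)) ¬Jk
          split : ∀ {b c} → b ∧ c ≡ true → b ≡ true × c ≡ true
          split {true} eq = refl , eq
          sub : ∀ k → (R ∖ i) k ∧ e a (swap k) ≡ true → J k ≡ true
          sub k eq with split {(R ∖ i) k} eq | J k in Jk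
          ... | _       | true  = refl
          ... | Rk , ek | false = contradiction (a-swap k Rk (inj₁ Jk)) (true≢false ek)
          ¬k₀ : (R ∖ i) k₀ ∧ e a (swap k₀) ≡ false
          ¬k₀ = ¬-not (λ eq → let Rk , ek = split {(R ∖ i) k₀} eq in true≢false ek (a-swap k₀ Rk (inj₂ refl)))

    module _ (D : Domination p′ R′ X′ i) where

      private
        module D = Domination D

        S Z : _
        S = D.S ⊎ₗ J
        Z = D.Z ++ star

        S*⇒¬J : ∀ k → D.S k ≡ true → J k ≡ false
        S*⇒¬J k = proj₂ ∘ R′⁻ ∘ D.S⊆R k

        size-S : size S ≡ size D.S + size J
        size-S = size-⊎ₗ D.S J S*⇒¬J

        length-Z : length Z ≡ length D.Z + suc (size J)
        length-Z = trans (length-++ D.Z) (cong (length D.Z +_) length-star)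

        star⊆X : ∀ {v} → v ∈ star → X v
        star⊆X v∈ with star⁻ v∈
        ... | inj₁ refl = a∈X
        ... | inj₂ (k , Jk , refl) = rep-in τ k (proj₁ (J⁻ Jk))

        Z⊆X : ∀ z → z ∈ Z → X z
        Z⊆X z z∈ with ∈-++⁻ D.Z z∈
        ... | inj₁ z∈* = proj₁ (D.Z⊆X z z∈*)
        ... | inj₂ z∈s = star⊆X z∈s

        -- A vertex without a neighbour in `star` survives in `X′`, and its merged label is in
        -- `D.S`, since the labels of `J` have become the root `i`.
        dom : ∀ v → X v → S (p v) ≡ true → 1 ≤ degree Z v
        dom v v∈X Sv rewrite total-++ (λ w → 𝟙 (e w v)) D.Z star with degree star v in eq
        ... | suc d = ≤-trans (s≤s z≤n) (m≤n+m (suc d) (degree D.Z v))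
        ... | zero  = ≤-trans (D.dom v (v∈X , eq) S*v) (m≤m+n _ 0)
          where
          S*v : D.S (p′ v) ≡ true
          S*v with ⊎ₗ⁻ D.S J Sv
          ... | inj₁ y rewrite S*⇒¬J (p v) y = y
          ... | inj₂ (_ , y) rewrite y = D.root

        -- With exactly one neighbour b = I j, whichever of the labels i and j is left free by a
        -- transversal of the merged labels can be represented by a or b.
        swappable : ∀ {j} → J j ≡ true → size J ≤ 1 → Swappable p′ D.S D.Z → Swappable p S Z
        swappable {j} j∈J J≤1 sw k k∈S = choose (k Fin.≟ i) (J k Bool.≟ true)
          where
          open Transversal
          S⇒S* : ∀ {l} → S l ≡ true → J l ≢ true → D.S l ≡ true
          S⇒S* Sl ¬Jl with ⊎ₗ⁻ D.S J Sl
          ... | inj₁ y = y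
          ... | inj₂ (_ , Jl) = contradiction Jl ¬Jl
          Z*⇒Z : ∀ {z} → z ∈ D.Z → z ∈ Z
          Z*⇒Z = ∈-++⁺ˡ
          star⇒Z : ∀ {z} → z ∈ star → z ∈ Z
          star⇒Z = ∈-++⁺ʳ D.Z

          old-new : ∀ {u v} → u ∈ D.Z → v ∈ star → e v u ≡ false
          old-new {u} u∈ v∈ = degree≡0⇒e {star} (proj₂ (D.Z⊆X u u∈)) v∈

          -- Only one vertex of `star` is used, because `a` and its neighbour are adjacent; the
          -- remaining ones come from `D.Z` and so have no neighbour in the star.
          assemble : ∀ m γ (f : Fin r → V) (fresh : V) → fresh ∈ star →
                     (∀ l → (S ∖ k) l ≡ true → p (f l) ≡ l) →
                     (∀ l → (S ∖ k) l ≡ true → f l ≡ fresh ⊎ ∃ λ l′ → (D.S ∖ m) l′ ≡ true × f l ≡ rep γ l′) →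
                     Transversal p (S ∖ k) (_∈ Z)
          assemble m γ f fresh fr lab origin .rep = f
          assemble m γ f fresh fr lab origin .rep-label = lab
          assemble m γ f fresh fr lab origin .rep-in l l∈ with origin l l∈
          ... | inj₁ eq rewrite eq = star⇒Z fr
          ... | inj₂ (l′ , l′∈ , eq) rewrite eq = Z*⇒Z (rep-in γ l′ l′∈)
          assemble m γ f fresh fr lab origin .independent l l₂ l∈ l₂∈ with origin l l∈ | origin l₂ l₂∈
          ... | inj₁ eq | inj₁ eq₂ rewrite eq | eq₂ = e-irrefl fresh
          ... | inj₁ eq | inj₂ (m₂ , m₂∈ , eq₂) rewrite eq | eq₂ = old-new (rep-in γ m₂ m₂∈) fr
          ... | inj₂ (m₁ , m₁∈ , eq) | inj₁ eq₂ rewrite eq | eq₂ = e-flip (old-new (rep-in γ m₁ m₁∈) fr)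
          ... | inj₂ (m₁ , m₁∈ , eq) | inj₂ (m₂ , m₂∈ , eq₂) rewrite eq | eq₂ = independent γ m₁ m₂ m₁∈ m₂∈

          use-a : ∀ m (γ : Transversal p′ (D.S ∖ m) (_∈ D.Z)) →
                  (∀ l → (S ∖ k) l ≡ true → J l ≢ true → l ≢ i → (D.S ∖ m) l ≡ true) →
                  (∀ l → (S ∖ k) l ≡ true → J l ≡ true → (D.S ∖ m) i ≡ true × p (rep γ i) ≡ l) →
                  Transversal p (S ∖ k) (_∈ Z)
          use-a m γ out in-J = assemble m γ f a (here refl) label origin
            where
            f : Fin r → V
            f l with l Fin.≟ i | J l Bool.≟ true
            ... | yes _ | _     = a
            ... | no  _ | yes _ = rep γ i
            ... | no  _ | no  _ = rep γ l
            label : ∀ l → (S ∖ k) l ≡ true → p (f l) ≡ l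
            label l l∈ with l Fin.≟ i | J l Bool.≟ true
            ... | yes refl | _      = pa
            ... | no  _    | yes Jl = proj₂ (in-J l l∈ Jl)
            ... | no  l≢i  | no ¬Jl = p′≡⇒p≡ (rep-label γ l (out l l∈ ¬Jl l≢i)) l≢i
            origin : ∀ l → (S ∖ k) l ≡ true → f l ≡ a ⊎ ∃ λ l′ → (D.S ∖ m) l′ ≡ true × f l ≡ rep γ l′
            origin l l∈ with l Fin.≟ i | J l Bool.≟ true
            ... | yes refl | _      = inj₁ refl
            ... | no  _    | yes Jl = inj₂ (i , proj₁ (in-J l l∈ Jl) , refl)
            ... | no  l≢i  | no ¬Jl = inj₂ (l , out l l∈ ¬Jl l≢i , refl)

          use-b : ∀ m (γ : Transversal p′ (D.S ∖ m) (_∈ D.Z)) →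
                  (∀ l → (S ∖ k) l ≡ true → J l ≢ true → (D.S ∖ m) l ≡ true × (l ≡ i → p (rep γ i) ≡ i)) →
                  Transversal p (S ∖ k) (_∈ Z)
          use-b m γ out = assemble m γ f (I j) (I∈star j∈J) label origin
            where
            f : Fin r → V
            f l with J l Bool.≟ true
            ... | yes _ = I l
            ... | no  _ = rep γ l
            label : ∀ l → (S ∖ k) l ≡ true → p (f l) ≡ l
            label l l∈ with J l Bool.≟ true
            ... | yes Jl = rep-label τ l (proj₁ (J⁻ Jl))
            ... | no ¬Jl with l Fin.≟ i
            ...   | yes refl = proj₂ (out l l∈ ¬Jl) refl
            ...   | no  l≢i  = p′≡⇒p≡ (rep-label γ l (proj₁ (out l l∈ ¬Jl))) l≢i
            origin : ∀ l → (S ∖ k) l ≡ true → f l ≡ I j ⊎ ∃ λ l′ → (D.S ∖ m) l′ ≡ true × f l ≡ rep γ l′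
            origin l l∈ with J l Bool.≟ true
            ... | yes Jl = inj₁ (cong I (size-unique J l j J≤1 Jl j∈J))
            ... | no ¬Jl = inj₂ (l , proj₁ (out l l∈ ¬Jl) , refl)

          inside : ∀ {l} → (S ∖ k) l ≡ true → J l ≢ true → D.S l ≡ true × l ≢ k
          inside l∈ ¬Jl = let Sl , l≢k = ∖⁻ S l∈ in S⇒S* Sl ¬Jl , l≢k

          choose : Dec (k ≡ i) → Dec (J k ≡ true) → Transversal p (S ∖ k) (_∈ Z)
          choose (yes refl) _ = use-b i (sw i D.root) λ l l∈ ¬Jl →
            let Sl , l≢i = inside l∈ ¬Jl in ∖⁺ D.S Sl l≢i , λ l≡i → contradiction l≡i l≢i
          choose (no k≢i) (yes Jk) = use-a i (sw i D.root)
            (λ l l∈ ¬Jl l≢i → ∖⁺ D.S (proj₁ (inside l∈ ¬Jl)) l≢i)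
            (λ l l∈ Jl → contradiction (size-unique J l k J≤1 Jl Jk) (proj₂ (∖⁻ S l∈)))
          choose (no k≢i) (no ¬Jk) with p′≡i (rep-label γ i i∈)
            where
            γ : Transversal p′ (D.S ∖ k) (_∈ D.Z)
            γ = sw k (S⇒S* k∈S ¬Jk)
            i∈ : (D.S ∖ k) i ≡ true
            i∈ = ∖⁺ D.S D.root (k≢i ∘ sym)
          ... | inj₁ at-i = use-b k (sw k (S⇒S* k∈S ¬Jk)) λ l l∈ ¬Jl →
            let Sl , l≢k = inside l∈ ¬Jl in ∖⁺ D.S Sl l≢k , λ _ → at-i
          ... | inj₂ in-J = use-a k (sw k (S⇒S* k∈S ¬Jk))
            (λ l l∈ ¬Jl _ → let Sl , l≢k = inside l∈ ¬Jl in ∖⁺ D.S Sl l≢k)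
            (λ l l∈ Jl → ∖⁺ D.S D.root (k≢i ∘ sym) , size-unique J _ l J≤1 in-J Jl)

        -- With |J| = q + 1, the list grows by q + 2 vertices and 2|S| by 2q + 2. So |J| = 1 gains
        -- nothing and swappability has to be carried over, while |J| ≥ 2 gains at least one and
        -- yields the first alternative.
        shape : ∀ {j} → J j ≡ true → (length Z + 3 ≤ 2 * size S) ⊎ (length Z + 2 ≤ 2 * size S × Swappable p S Z)
        shape {j} j∈J rewrite length-Z | size-S with D.shape | size J in eq
        ... | _                   | zero        = contradiction (0<size J j j∈J) (λ lt → n≮0 (subst (0 <_) eq lt))
        ... | inj₁ short          | suc q       = inj₁ (linear q short (ring₁ (length D.Z) q (size D.S)))
          where
          ring₁ : ∀ z q s → q + (z + suc (suc q) + 3) + 2 * s ≡ 2 * (s + suc q) + (z + 3)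
          ring₁ = solve-∀
        ... | inj₂ (len , sw)     | suc zero    = inj₂ (linear 0 len (ring₂ (length D.Z) (size D.S)) , swappable j∈J (≤-reflexive eq) sw)
          where
          ring₂ : ∀ z s → 0 + (z + 2 + 2) + 2 * s ≡ 2 * (s + 1) + (z + 2)
          ring₂ = solve-∀
        ... | inj₂ (len , _)      | suc (suc q) = inj₁ (linear q len (ring₃ (length D.Z) q (size D.S)))
          where
          ring₃ : ∀ z q s → q + (z + suc (suc (suc q)) + 3) + 2 * s ≡ 2 * (s + suc (suc q)) + (z + 2)
          ring₃ = solve-∀

      combine : ∀ {j} → J j ≡ true → Domination p R X i
      combine j∈J = record
        { S = S ; S⊆R = S⊆R ; root = ⊎ₗ⁺ˡ D.S J D.root ; Z = Z ; Z⊆X = Z⊆X ; dom = dom ; shape = shape j∈J }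
        where
        S⊆R : ∀ k → S k ≡ true → R k ≡ true
        S⊆R k Sk with ⊎ₗ⁻ D.S J Sk
        ... | inj₁ y = proj₁ (R′⁻ (D.S⊆R k y))
        ... | inj₂ (_ , Jk) = J⇒R Jk

  -- Haxell's induction.

  singleton-domination : ∀ p R X i → R i ≡ true → (Fin r → V) → (∀ v → p v ≡ i → ¬ X v) → Domination p R X i
  singleton-domination p R X i i∈R g none = record
    { S = ⁅ i ⁆ ; S⊆R = λ l l∈ → trans (cong R (⁅⁆⁻ l∈)) i∈R ; root = ⁅⁆⁺ i ; Z = [] ; Z⊆X = λ _ ()
    ; dom = λ v v∈X v∈S → contradiction v∈X (none v (⁅⁆⁻ v∈S))
    -- The empty list satisfies 0 + 2 ≤ 2|S|, and removing the only label of `S` leaves nothing to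
    -- represent.
    ; shape = inj₂ (*-monoʳ-≤ 2 (0<size ⁅ i ⁆ i (⁅⁆⁺ i)) , λ l l∈ → record
        { rep = g
        ; rep-label = λ k k∈ → ⊥-elim (empty l∈ k∈) ; rep-in = λ k k∈ → ⊥-elim (empty l∈ k∈)
        ; independent = λ k _ k∈ _ → ⊥-elim (empty l∈ k∈) }) }
    where
    empty : ∀ {k l} → ⁅ i ⁆ l ≡ true → (⁅ i ⁆ ∖ l) k ≡ true → ⊥
    empty l∈ k∈ = let k∈i , k≢l = ∖⁻ ⁅ i ⁆ k∈ in k≢l (trans (⁅⁆⁻ k∈i) (sym (⁅⁆⁻ l∈)))

  mutual

    -- `m` bounds |R|, and `n` in `via-star` bounds the number of neighbours of `a` in the current
    -- transversal: merging lowers the first, exchanging a representative the second. `X` is an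
    -- arbitrary predicate, so case distinctions are made under a double negation.
    rooted-domination : ∀ m p R X i → size R ≤ m → R i ≡ true → Transversal p (R ∖ i) X →
                        ¬ Transversal p R X → ¬ ¬ Domination p R X i
    rooted-domination zero p R X i R≤0 i∈R τ noT _ = contradiction (≤-trans (0<size R i i∈R) R≤0) λ()
    rooted-domination (suc m) p R X i R≤ i∈R τ noT k = ¬¬-em {∃ λ a → p a ≡ i × X a} λ where
      (inj₁ (a , pa , a∈X)) → via-star m _ p R X i R≤ i∈R τ noT a pa a∈X ≤-refl k
      (inj₂ none) → k (singleton-domination p R X i i∈R (rep τ) (λ v pv v∈X → none (v , pv , v∈X)))

    via-star : ∀ m n p R X i → size R ≤ suc m → R i ≡ true → (τ : Transversal p (R ∖ i) X) →
               ¬ Transversal p R X → ∀ a → p a ≡ i → X a →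
               size (λ k → (R ∖ i) k ∧ e a (rep τ k)) ≤ n → ¬ ¬ Domination p R X i
    via-star m zero p R X i R≤ i∈R τ noT a pa a∈X J≤0 _ =
      has-neighbour λ j → ¬-not λ j∈J → n≮0 (≤-trans (0<size J j j∈J) J≤0)
      where open Explosion p R X i i∈R a pa a∈X τ noT
    via-star m (suc n) p R X i R≤ i∈R τ noT a pa a∈X J≤n k = has-neighbour λ j → ¬-not (explode j)
      where
      open Explosion p R X i i∈R a pa a∈X τ noT
      explode : ∀ j → J j ≢ true
      explode j j∈J = ¬¬-em {Transversal p′ R′ X′} λ where
        (inj₂ noT′) → rooted-domination m p′ R′ X′ i (≤-pred (≤-trans (merging-shrinks j∈J) R≤)) (R′⁺ i∈R i∉J) τ′ noT′
          (λ D → k (combine D j∈J))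
        (inj₁ γ) → case p′≡i (rep-label γ i (R′⁺ i∈R i∉J)) of λ where
          (inj₁ at-i) → unmerged-root γ at-i
          (inj₂ in-J) → let open Swap γ in-J in
            via-star m n p R X i R≤ i∈R swapped noT a pa a∈X (≤-pred (≤-trans fewer J≤n)) k

  -- Labels are removed until the rest admits a transversal, at the latest when nothing is left; the
  -- label removed last becomes the root.
  domination : ∀ m p R X → V → size R ≤ m → ¬ Transversal p R X → ¬ ¬ ∃ (Domination p R X)
  domination m p R X v₀ R≤m noT k = noT record
    { rep = λ _ → v₀
    ; rep-label = λ l l∈ → ⊥-elim (nonempty m R≤m l l∈) ; rep-in = λ l l∈ → ⊥-elim (nonempty m R≤m l l∈)
    ; independent = λ l _ l∈ _ → ⊥-elim (nonempty m R≤m l l∈) }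
    where
    nonempty : ∀ m → size R ≤ m → ∀ l → R l ≡ true → ⊥
    nonempty zero R≤ l l∈ = n≮0 (≤-trans (0<size R l l∈) R≤)
    nonempty (suc m) R≤ l l∈ = ¬¬-em {Transversal p (R ∖ l) X} λ where
      (inj₁ τ) → rooted-domination _ p R X l ≤-refl l∈ τ noT (λ D → k (l , D))
      (inj₂ noT′) → domination m p (R ∖ l) X v₀ (≤-pred (≤-trans (size-∖ R l l∈) R≤)) noT′ λ where
        (i , D) → let open Domination D in
          k (i , record { S = S ; S⊆R = λ k Sk → proj₁ (∖⁻ R (S⊆R k Sk)) ; root = root ; Z = Z ; Z⊆X = Z⊆X
                        ; dom = dom ; shape = shape })

total-cartesianProduct : ∀ {A B : Set} (f : A → ℕ) (xs : List A) (ys : List B) →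
                         total (cartesianProduct xs ys) (f ∘ proj₁) ≡ total xs f * length ys
total-cartesianProduct f []       ys = refl
total-cartesianProduct f (x ∷ xs) ys = begin
  total (map (x ,_) ys ++ cartesianProduct xs ys) (f ∘ proj₁)
    ≡⟨ total-++ (f ∘ proj₁) (map (x ,_) ys) (cartesianProduct xs ys) ⟩
  total (map (x ,_) ys) (f ∘ proj₁) + total (cartesianProduct xs ys) (f ∘ proj₁)
    ≡⟨ cong₂ _+_ (row ys) (total-cartesianProduct f xs ys) ⟩
  f x * length ys + total xs f * length ys
    ≡⟨ *-distribʳ-+ (length ys) (f x) (total xs f) ⟨
  (f x + total xs f) * length ys ∎
  where
  open ≡-Reasoning
  row : ∀ ys → total (map (x ,_) ys) (f ∘ proj₁) ≡ f x * length ys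
  row []       = sym (*-zeroʳ (f x))
  row (y ∷ ys) = trans (cong (f x +_) (row ys)) (sym (*-suc (f x) (length ys)))

-- Graphs of bounded degree without independent transversal

module Bounded (r t Δ s : ℕ) (t+s≡2Δ : t + s ≡ 2 * Δ)
               (e : Fin r × Fin t → Fin r × Fin t → Bool)
               (e-sym : ∀ u v → e u v ≡ e v u) (e-irrefl : ∀ v → e v v ≡ false)
               (degree≤Δ : ∀ w → total (cartesianProduct (allFin r) (allFin t)) (λ v → 𝟙 (e w v)) ≤ Δ) where

  open Transversals r e e-sym e-irrefl

  V : Set
  V = Fin r × Fin t

  part : V → Fin r
  part = proj₁

  vertices : List V
  vertices = cartesianProduct (allFin r) (allFin t)

  -- Edges from `A` into the parts of `S` and into the other parts, counted with the multiplicities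
  -- in `A`.
  inside outside : LabelSet → List V → ℕ
  inside  S A = total vertices (λ v → 𝟙 (S (part v)) * degree A v)
  outside S A = total vertices (λ v → 𝟙 (not (S (part v))) * degree A v)

  total-degree : ∀ A → total vertices (degree A) ≤ length A * Δ
  total-degree []      = ≤-reflexive (zeros vertices)
    where
    zeros : ∀ vs → total {V} vs (λ _ → 0) ≡ 0
    zeros []       = refl
    zeros (_ ∷ vs) = zeros vs
  total-degree (w ∷ A) = ≤-trans
    (≤-reflexive (total-+ (λ v → 𝟙 (e w v)) (degree A) vertices))
    (+-mono-≤ (degree≤Δ w) (total-degree A))

  private
    zeros : ∀ (f : V → ℕ) vs → total vs (λ v → f v * 0) ≡ 0
    zeros f []       = refl
    zeros f (v ∷ vs) = cong₂ _+_ (*-zeroʳ (f v)) (zeros f vs)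

  inside-[] : ∀ S → inside S [] ≡ 0
  inside-[] S = zeros (𝟙 ∘ S ∘ part) vertices

  outside-[] : ∀ S → outside S [] ≡ 0
  outside-[] S = zeros (𝟙 ∘ not ∘ S ∘ part) vertices

  inside+outside : ∀ S A → inside S A + outside S A ≤ length A * Δ
  inside+outside S A = ≤-trans
    (≤-reflexive (trans (sym (total-+ _ _ vertices)) (total-cong vertices pointwise)))
    (total-degree A)
    where
    pointwise : ∀ v → 𝟙 (S (part v)) * degree A v + 𝟙 (not (S (part v))) * degree A v ≡ degree A v
    pointwise v with S (part v)
    ... | true  = trans (+-identityʳ _) (+-identityʳ _)
    ... | false = +-identityʳ _

  inside≤outside : ∀ S C A → (∀ k → S k ≡ true → C k ≡ false) → inside S A ≤ outside C A
  inside≤outside S C A disj = total-mono vertices λ v → *-monoˡ-≤ (degree A v) (le v)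
    where
    le : ∀ v → 𝟙 (S (part v)) ≤ 𝟙 (not (C (part v)))
    le v = 𝟙-mono (λ Sv → cong not (disj (part v) Sv))

  outside-∷ : ∀ S y A → outside S A ≤ outside S (y ∷ A)
  outside-∷ S y A = total-mono vertices λ v → *-monoʳ-≤ (𝟙 (not (S (part v)))) (m≤n+m (degree A v) (𝟙 (e y v)))

  size≤r : ∀ S → size S ≤ r
  size≤r S = ≤-trans (ones (allFin r)) (≤-reflexive (length-tabulate id))
    where
    ones : ∀ ks → total ks (𝟙 ∘ S) ≤ length ks
    ones []       = z≤n
    ones (k ∷ ks) = +-mono-≤ (𝟙-mono {S k} {true} (λ _ → refl)) (ones ks)

  size-vertices : ∀ S → total vertices (λ v → 𝟙 (S (part v))) ≡ size S * t
  size-vertices S = trans (total-cartesianProduct (𝟙 ∘ S) (allFin r) (allFin t)) (cong (size S *_) (length-tabulate id))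

  -- Double counting: |S|t is at most `inside S A` + `inside S B`, and `inside S B` is at most |B|Δ
  -- - `outside S B`. Substituting |B| ≤ 2|S| - q and t = 2Δ - s leaves |S|s on the right.
  cover-bound : ∀ S A B {d} q → (∀ v → S (part v) ≡ true → 1 ≤ degree A v + degree B v) →
                inside S A ≤ d → length B + q ≤ 2 * size S →
                outside S B + q * Δ ≤ d + size S * s
  cover-bound S A B {d} q cover A≤d len =
    linear 0 (+-mono-≤ (+-mono-≤ covered A≤d) (+-mono-≤ (inside+outside S B) (*-monoˡ-≤ Δ len)))
      (trans (ring₁ (outside S B) (size S) s t Δ d (inside S A) (inside S B) q (length B))
        (trans (cong (λ x → outside S B + q * Δ + d + inside S A + inside S B + length B * Δ + size S * x) (sym t+s≡2Δ))
          (ring₂ (outside S B) (size S) s t Δ d (inside S A) (inside S B) q (length B))))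
    where
    pointwise : ∀ v → 𝟙 (S (part v)) ≤ 𝟙 (S (part v)) * degree A v + 𝟙 (S (part v)) * degree B v
    pointwise v with S (part v) | cover v
    ... | false | _ = z≤n
    ... | true  | c rewrite +-identityʳ (degree A v) | +-identityʳ (degree B v) = c refl
    covered : size S * t ≤ inside S A + inside S B
    covered = begin
      size S * t                                 ≡⟨ size-vertices S ⟨
      total vertices (λ v → 𝟙 (S (part v)))      ≤⟨ total-mono vertices pointwise ⟩
      total vertices (λ v → 𝟙 (S (part v)) * degree A v + 𝟙 (S (part v)) * degree B v) ≡⟨ total-+ _ _ vertices ⟩
      inside S A + inside S B                    ∎
      where open ≤-Reasoning
    ring₁ : ∀ o c s t Δ d iA iB q lB →
      0 + (o + q * Δ) + (iA + iB + d + (lB * Δ + 2 * c * Δ)) ≡ o + q * Δ + d + iA + iB + lB * Δ + c * (2 * Δ)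
    ring₁ = solve-∀
    ring₂ : ∀ o c s t Δ d iA iB q lB →
      o + q * Δ + d + iA + iB + lB * Δ + c * (t + s) ≡ d + c * s + (c * t + iA + (iB + o + (lB + q) * Δ))
    ring₂ = solve-∀

  all : LabelSet
  all _ = true

  -- Configurations and the steps between them.

  module NoTransversal (noT : ¬ Transversal part all (λ _ → ⊤)) where

    undominated : ∀ S A q → length A + q ≤ 2 * size S → size S * s < q * Δ →
                  ¬ ¬ ∃ λ v → S (part v) ≡ true × degree A v ≡ 0
    undominated S A q len small none = <-irrefl refl (≤-trans small
      (m+n≤o⇒n≤o (outside S A) (cover-bound S [] A q cover (≤-reflexive (inside-[] S)) len)))
      where
      cover : ∀ v → S (part v) ≡ true → 1 ≤ degree A v
      cover v Sv with degree A v in eq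
      ... | zero  = contradiction (v , Sv , eq) none
      ... | suc _ = s≤s z≤n

    record Configuration (C : LabelSet) (W : List V) (x : V) : Set where
      field
        short : length W + 2 ≤ 2 * size C
        swap  : Swappable part C W
        x∉C   : C (part x) ≡ false
        x≁W   : degree W x ≡ 0

    leak : LabelSet → List V → V → ℕ
    leak C W x = outside C (x ∷ W)

    -- The alternatives in `result` are the two shapes of a domination, which give q = 2 and q = 1
    -- in `cover-bound`. `bound` expresses that `S` avoids the labels `P` represented before.
    record Outcome (P : LabelSet) (y : V) (d : ℕ) : Set where
      field
        S      : LabelSet
        bound  : size S + size P ≤ r
        result : (2 * Δ ≤ d + size S * s) ⊎
                 ∃ λ Z → Configuration S Z y × leak S Z y + Δ ≤ d + size S * s

    -- A transversal of the labels outside `P` by vertices not adjacent to `y` and `A` would extend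
    -- `π` to all labels, so these labels have a domination. Since `S` avoids `C`, the edges from
    -- `A` into `S` are among those leaving `C`, hence at most `d`.
    core : ∀ P C y A d → Transversal part P (_∈ y ∷ A) → P (part y) ≡ true →
           (∀ k → C k ≡ true → P k ≡ true) → outside C A ≤ d → ¬ ¬ Outcome P y d
    core P C y A d π y∈P C⊆P A≤d k = domination _ part R X y ≤-refl noT-R λ (i , D) → outcome i D
      where
      R : LabelSet
      R = not ∘ P
      X : V → Set
      X v = degree (y ∷ A) v ≡ 0
      noT-R : ¬ Transversal part R X
      noT-R γ = noT record { rep = g ; rep-label = label ; rep-in = λ _ _ → tt ; independent = indep }
        where
        g : Fin r → V
        g k with P k
        ... | true  = rep π k
        ... | false = rep γ k
        label : ∀ k → true ≡ true → part (g k) ≡ k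
        label k _ with P k in Pk
        ... | true  = rep-label π k Pk
        ... | false = rep-label γ k (cong not Pk)
        indep : ∀ k l → true ≡ true → true ≡ true → e (g k) (g l) ≡ false
        indep k l _ _ with P k in Pk | P l in Pl
        ... | true  | true  = independent π k l Pk Pl
        ... | true  | false = degree≡0⇒e {y ∷ A} (rep-in γ l (cong not Pl)) (rep-in π k Pk)
        ... | false | true  = e-flip (degree≡0⇒e {y ∷ A} (rep-in γ k (cong not Pk)) (rep-in π l Pl))
        ... | false | false = independent γ k l (cong not Pk) (cong not Pl)
      outcome : ∀ i → Domination part R X i → ⊥
      outcome i D = k record { S = S ; bound = bound ; result = result shape }
        where
        open Domination D
        S⇒¬P : ∀ k → S k ≡ true → P k ≡ false
        S⇒¬P k Sk = not-injective (S⊆R k Sk)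
        bound : size S + size P ≤ r
        bound = ≤-trans (≤-reflexive (sym (size-⊎ₗ S P S⇒¬P))) (size≤r (S ⊎ₗ P))
        S⇒¬C : ∀ k → S k ≡ true → C k ≡ false
        S⇒¬C k Sk = ¬-not λ Ck → true≢false (C⊆P k Ck) (S⇒¬P k Sk)
        assoc-swap : ∀ a b c → a + b + c ≡ b + (a + c)
        assoc-swap = solve-∀
        -- `y` is counted with `Z` and not with `A`, since its edges belong to the leak of the new
        -- configuration.
        cover : ∀ v → S (part v) ≡ true → 1 ≤ degree A v + degree (y ∷ Z) v
        cover v Sv = subst (1 ≤_) (assoc-swap (𝟙 (e y v)) (degree A v) (degree Z v)) split
          where
          split : 1 ≤ degree (y ∷ A) v + degree Z v
          split with degree (y ∷ A) v in eq
          ... | zero  = dom v eq Sv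
          ... | suc _ = s≤s z≤n
        A≤ : inside S A ≤ d
        A≤ = ≤-trans (inside≤outside S C A S⇒¬C) A≤d
        result : (length Z + 3 ≤ 2 * size S) ⊎ (length Z + 2 ≤ 2 * size S × Swappable part S Z) →
                 (2 * Δ ≤ d + size S * s) ⊎ ∃ λ Z → Configuration S Z y × leak S Z y + Δ ≤ d + size S * s
        result (inj₁ len) = inj₁ (m+n≤o⇒n≤o (leak S Z y)
          (cover-bound S A (y ∷ Z) 2 cover A≤ (≤-trans (≤-reflexive (sym (+-suc (length Z) 2))) len)))
        result (inj₂ (len , sw)) = inj₂ (Z ,
          record { short = len ; swap = sw ; x∉C = ¬-not (λ Sy → true≢false y∈P (S⇒¬P _ Sy))
                 ; x≁W = e⇒degree≡0 {Z} (λ w w∈ → e-flip (degree≡0⇒e {y ∷ A} (Z⊆X w w∈) (here refl))) } ,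
          subst (λ q → leak S Z y + q ≤ d + size S * s) (*-identityˡ Δ)
            (cover-bound S A (y ∷ Z) 1 cover A≤ (≤-trans (≤-reflexive (sym (+-suc (length Z) 1))) len)))

    add-representative : ∀ {C W} y → Swappable part C W → C (part y) ≡ true → degree W y ≡ 0 →
                         Transversal part C (_∈ y ∷ W)
    add-representative {C} {W} y sw y∈C y≁W =
      record { rep = g ; rep-label = label ; rep-in = g-in ; independent = indep }
      where
      σ : Transversal part (C ∖ part y) (_∈ W)
      σ = sw (part y) y∈C
      g : Fin r → V
      g k with k Fin.≟ part y
      ... | yes _ = y
      ... | no  _ = rep σ k
      label : ∀ k → C k ≡ true → part (g k) ≡ k
      label k Ck with k Fin.≟ part y
      ... | yes eq = sym eq
      ... | no  k≢ = rep-label σ k (∖⁺ C Ck k≢)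
      g-in : ∀ k → C k ≡ true → g k ∈ y ∷ W
      g-in k Ck with k Fin.≟ part y
      ... | yes eq = here refl
      ... | no  k≢ = there (rep-in σ k (∖⁺ C Ck k≢))
      y≁ : ∀ k → C k ≡ true → k ≢ part y → e (rep σ k) y ≡ false
      y≁ k Ck k≢ = degree≡0⇒e {W} y≁W (rep-in σ k (∖⁺ C Ck k≢))
      indep : ∀ k l → C k ≡ true → C l ≡ true → e (g k) (g l) ≡ false
      indep k l Ck Cl with k Fin.≟ part y | l Fin.≟ part y
      ... | yes _  | yes _  = e-irrefl y
      ... | yes _  | no  l≢ = e-flip (y≁ l Cl l≢)
      ... | no  k≢ | yes _  = y≁ k Ck k≢
      ... | no  k≢ | no  l≢ = independent σ k l (∖⁺ C Ck k≢) (∖⁺ C Cl l≢)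

    -- `W` and `y` represent `C`, and `x` can be added for its own part because it is adjacent to
    -- neither; `core` then treats the remaining parts.
    step : ∀ {C W x} → Configuration C W x → ∀ y → C (part y) ≡ true → degree (x ∷ W) y ≡ 0 →
           ¬ ¬ Outcome (C ⊎ₗ ⁅ part x ⁆) y (leak C W x)
    step {C} {W} {x} K y y∈C y≁ =
      core P C y (x ∷ W) _ π (⊎ₗ⁺ˡ C ⁅ part x ⁆ y∈C) (λ k → ⊎ₗ⁺ˡ C ⁅ part x ⁆) ≤-refl
      where
      open Configuration K
      P : LabelSet
      P = C ⊎ₗ ⁅ part x ⁆
      x≁y : e x y ≡ false
      x≁y = degree≡0⇒e {x ∷ W} y≁ (here refl)
      σ : Transversal part C (_∈ y ∷ W)
      σ = add-representative y swap y∈C (e⇒degree≡0 {W} (λ w w∈ → degree≡0⇒e {x ∷ W} y≁ (there w∈)))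
      σ≁x : ∀ k → C k ≡ true → e (rep σ k) x ≡ false
      σ≁x k Ck with rep-in σ k Ck
      ... | here eq rewrite eq = e-flip x≁y
      ... | there w∈ = degree≡0⇒e {W} x≁W w∈
      P⁻ : ∀ {k} → P k ≡ true → C k ≢ true → k ≡ part x
      P⁻ Pk ¬Ck with ⊎ₗ⁻ C ⁅ part x ⁆ Pk
      ... | inj₁ Ck = contradiction Ck ¬Ck
      ... | inj₂ (_ , k∈) = ⁅⁆⁻ k∈
      π : Transversal part P (_∈ y ∷ x ∷ W)
      π = record { rep = g ; rep-label = label ; rep-in = g-in ; independent = indep }
        where
        g : Fin r → V
        g k with C k Bool.≟ true
        ... | yes _ = rep σ k
        ... | no  _ = x
        label : ∀ k → P k ≡ true → part (g k) ≡ k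
        label k Pk with C k Bool.≟ true
        ... | yes Ck = rep-label σ k Ck
        ... | no ¬Ck = sym (P⁻ Pk ¬Ck)
        g-in : ∀ k → P k ≡ true → g k ∈ y ∷ x ∷ W
        g-in k Pk with C k Bool.≟ true
        ... | no _ = there (here refl)
        ... | yes Ck with rep-in σ k Ck
        ...   | here eq = here eq
        ...   | there w∈ = there (there w∈)
        indep : ∀ k l → P k ≡ true → P l ≡ true → e (g k) (g l) ≡ false
        indep k l Pk Pl with C k Bool.≟ true | C l Bool.≟ true
        ... | yes Ck | yes Cl = independent σ k l Ck Cl
        ... | yes Ck | no  _  = σ≁x k Ck
        ... | no  _  | yes Cl = e-flip (σ≁x l Cl)
        ... | no  _  | no  _  = e-irrefl x

    size-⊎⁅⁆ : ∀ C k → C k ≡ false → size C + 1 ≤ size (C ⊎ₗ ⁅ k ⁆)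
    size-⊎⁅⁆ C k ¬Ck = ≤-trans (+-monoʳ-≤ (size C) (0<size ⁅ k ⁆ k (⁅⁆⁺ k)))
      (≤-reflexive (sym (size-⊎ₗ C ⁅ k ⁆ λ l Cl → ¬-not λ l∈ → true≢false Cl (trans (cong C (⁅⁆⁻ l∈)) ¬Ck))))

    -- Either shape gives a dominating list of at most 2|S| - 2 vertices, too few if rs < 2Δ.
    haxell-bound : V → 2 * Δ ≤ r * s
    haxell-bound v₀ = ≮⇒≥ λ rs<2Δ → domination _ part all (λ _ → ⊤) v₀ ≤-refl noT λ (i , D) → impossible rs<2Δ D
      where
      impossible : r * s < 2 * Δ → ∀ {i} → Domination part all (λ _ → ⊤) i → ⊥
      impossible rs<2Δ D = undominated S Z 2 len (≤-<-trans (*-monoˡ-≤ s (size≤r S)) rs<2Δ)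
        λ (v , Sv , eq) → <-irrefl (sym eq) (dom v tt Sv)
        where
        open Domination D
        len : length Z + 2 ≤ 2 * size S
        len with shape
        ... | inj₁ l = ≤-trans (+-monoʳ-≤ (length Z) (n≤1+n 2)) l
        ... | inj₂ (l , _) = l

    -- The descent for an odd number of parts.

    module Odd (h : ℕ) (r≡ : r ≡ 1 + 2 * h) (hs<Δ : h * s < Δ) (0<h : 0 < h) where

      private
        cs<Δ : ∀ {c} → c ≤ h → c * s < Δ
        cs<Δ c≤h = ≤-<-trans (*-monoˡ-≤ s c≤h) hs<Δ

        cs<2Δ : ∀ {c} → c ≤ 2 * h → c * s < 2 * Δ
        cs<2Δ {c} c≤2h = begin-strict
          c * s       ≤⟨ *-monoˡ-≤ s c≤2h ⟩
          2 * h * s   ≡⟨ *-assoc 2 h s ⟩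
          2 * (h * s) <⟨ *-monoʳ-< 2 hs<Δ ⟩
          2 * Δ       ∎
          where open ≤-Reasoning

        rs<3Δ : (1 + 2 * h) * s < 3 * Δ
        rs<3Δ = begin-strict
          (1 + 2 * h) * s ≤⟨ *-monoˡ-≤ s (+-monoˡ-≤ (2 * h) 0<h) ⟩
          3 * h * s       ≡⟨ *-assoc 3 h s ⟩
          3 * (h * s)     <⟨ *-monoʳ-< 3 hs<Δ ⟩
          3 * Δ           ∎
          where open ≤-Reasoning

        chain : ∀ l l′ l″ c c′ q → l′ + Δ ≤ l + c * s → l″ + q * Δ ≤ l′ + c′ * s →
                l″ + (1 + q) * Δ ≤ l + (c + c′) * s
        chain l l′ l″ c c′ q p p′ = linear 0 (+-mono-≤ p p′) (ring l l′ l″ c c′ q s Δ)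
          where
          ring : ∀ l l′ l″ c c′ q s Δ →
            0 + (l″ + (1 + q) * Δ) + (l + c * s + (l′ + c′ * s)) ≡ l + (c + c′) * s + (l′ + Δ + (l″ + q * Δ))
          ring = solve-∀

        l+cs<[1+c]s : ∀ {l} c → l < s → l + c * s < (1 + c) * s
        l+cs<[1+c]s c l<s = +-monoˡ-< (c * s) l<s

        1*Δ : ∀ {l m} → l + Δ ≤ m → l + 1 * Δ ≤ m
        1*Δ {l} {m} = subst (λ q → l + q ≤ m) (sym (*-identityˡ Δ))

      -- Progress over a configuration with `c` parts and leak `l`, where gaining a part outweighs
      -- any increase of the leak below `s`.
      Next : ℕ → ℕ → Set
      Next c l = ∃ λ C → ∃ λ W → ∃ λ x → Configuration C W x × size C ≤ h × leak C W x < s ×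
                 ((c ≤ size C × leak C W x < l) ⊎ c < size C)

      room : ∀ C x S → C (part x) ≡ false → size S + size (C ⊎ₗ ⁅ part x ⁆) ≤ r → size S + size C ≤ 2 * h
      room C x S x∉C bound = ≤-pred (begin
        suc (size S + size C)              ≡⟨ ring (size S) (size C) ⟩
        size S + (size C + 1)              ≤⟨ +-monoʳ-≤ (size S) (size-⊎⁅⁆ C (part x) x∉C) ⟩
        size S + size (C ⊎ₗ ⁅ part x ⁆)    ≤⟨ bound ⟩
        r                                  ≡⟨ r≡ ⟩
        suc (2 * h)                        ∎)
        where
        open ≤-Reasoning
        ring : ∀ a b → suc (a + b) ≡ a + (b + 1)
        ring = solve-∀

      -- Either S has a vertex not adjacent to y and Z, and a second step leads back to at most h parts,
      -- or y and Z dominate S, hence leak little, and a step across to the complement of S is cheap.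
      from-large : ∀ {c l S Z y} → Configuration S Z y → h < size S → size S + c ≤ 2 * h → l < s →
                   leak S Z y + Δ ≤ l + size S * s → ¬ ¬ Next c l
      from-large {c} {l} {S} {Z} {y} K h<S S+c≤2h l<s tight k =
        ¬¬-em {∃ λ z → S (part z) ≡ true × degree (y ∷ Z) z ≡ 0} λ where
          (inj₁ (z , z∈S , z≁)) → step K z z∈S z≁ λ O → again (Outcome.S O) z (room S y (Outcome.S O) x∉C (Outcome.bound O)) (Outcome.result O)
          (inj₂ none) → undominated S Z 2 short (cs<2Δ S≤2h) λ (u , u∈S , u≁Z) →
            core S S u Z _ (add-representative u swap u∈S u≁Z) u∈S (λ _ p → p) ≤-refl λ O →
              across u none (Outcome.S O) (Outcome.bound O) (Outcome.result O)
        where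
        open Configuration K
        S≤2h : size S ≤ 2 * h
        S≤2h = m+n≤o⇒m≤o (size S) S+c≤2h

        -- Both steps together give new leak + 2Δ ≤ l + (|S| + |S′|)s. As |S| + |S′| ≤ 2h, the leak
        -- drops below l; as l < s, equality |S| + |S′| = 2h is forced, whence c ≤ |S′| < h.
        again : ∀ S′ z → size S′ + size S ≤ 2 * h →
                (2 * Δ ≤ leak S Z y + size S′ * s) ⊎
                (∃ λ Z′ → Configuration S′ Z′ z × leak S′ Z′ z + Δ ≤ leak S Z y + size S′ * s) → ⊥
        again S′ z S′+S≤2h (inj₁ le) = <-irrefl refl (begin-strict
          3 * Δ                        ≤⟨ chain l (leak S Z y) 0 (size S) (size S′) 2 tight le ⟩
          l + (size S + size S′) * s   <⟨ l+cs<[1+c]s (size S + size S′) l<s ⟩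
          (1 + (size S + size S′)) * s ≤⟨ *-monoˡ-≤ s (s≤s (≤-trans (≤-reflexive (+-comm (size S) _)) S′+S≤2h)) ⟩
          (1 + 2 * h) * s              <⟨ rs<3Δ ⟩
          3 * Δ                        ∎)
          where open ≤-Reasoning
        again S′ z S′+S≤2h (inj₂ (Z′ , K′ , le)) =
          k (S′ , Z′ , z , K′ , <⇒≤ S′<h , <-trans smaller l<s , inj₁ (c≤S′ , smaller))
          where
          two : leak S′ Z′ z + 2 * Δ ≤ l + (size S + size S′) * s
          two = chain l (leak S Z y) (leak S′ Z′ z) (size S) (size S′) 1 tight (1*Δ {leak S′ Z′ z} le)
          S+S′≤2h : size S + size S′ ≤ 2 * h
          S+S′≤2h = ≤-trans (≤-reflexive (+-comm (size S) _)) S′+S≤2h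
          smaller : leak S′ Z′ z < l
          smaller = +-cancelʳ-< (2 * Δ) _ _ (≤-<-trans two (+-monoʳ-< l (cs<2Δ S+S′≤2h)))
          2h≤S+S′ : 2 * h ≤ size S + size S′
          2h≤S+S′ = ≮⇒≥ λ lt → <-irrefl refl (begin-strict
            2 * Δ                        ≤⟨ m+n≤o⇒n≤o (leak S′ Z′ z) two ⟩
            l + (size S + size S′) * s   <⟨ l+cs<[1+c]s (size S + size S′) l<s ⟩
            (1 + (size S + size S′)) * s <⟨ cs<2Δ lt ⟩
            2 * Δ                        ∎)
            where open ≤-Reasoning
          c≤S′ : c ≤ size S′
          c≤S′ = +-cancelˡ-≤ (size S) c (size S′) (≤-trans S+c≤2h 2h≤S+S′)
          S′<h : size S′ < h
          S′<h = +-cancelˡ-< h (size S′) h (begin-strict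
            h + size S′      <⟨ +-monoˡ-< (size S′) h<S ⟩
            size S + size S′ ≤⟨ S+S′≤2h ⟩
            2 * h            ≡⟨ cong (h +_) (+-identityʳ h) ⟩
            h + h            ∎)
            where open ≤-Reasoning

        -- Domination of `S` by `y` and `Z` gives `outside S Z` + Δ ≤ |S|s. Here `S` alone is
        -- represented, so `S′` may use the whole complement. The estimates force |S| + |S′| = 2h +
        -- 1, hence c < |S′| ≤ h, with a leak below s.
        across : ∀ u → ¬ (∃ λ z → S (part z) ≡ true × degree (y ∷ Z) z ≡ 0) → ∀ S′ → size S′ + size S ≤ r →
                 (2 * Δ ≤ outside S Z + size S′ * s) ⊎
                 (∃ λ Z′ → Configuration S′ Z′ u × leak S′ Z′ u + Δ ≤ outside S Z + size S′ * s) → ⊥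
        across u none S′ S′+S≤r = λ where
            (inj₁ le) → <-irrefl refl (≤-<-trans (≤-trans (chain 0 (outside S Z) 0 (size S) (size S′) 2 S-tight le) S+S′-s) rs<3Δ)
            (inj₂ (Z′ , K′ , le)) → finish Z′ K′ (chain 0 (outside S Z) (leak S′ Z′ u) (size S) (size S′) 1 S-tight (1*Δ {leak S′ Z′ u} le))
          where
          cover : ∀ v → S (part v) ≡ true → 1 ≤ 0 + degree (y ∷ Z) v
          cover v Sv with degree (y ∷ Z) v in eq
          ... | zero  = contradiction (v , Sv , eq) none
          ... | suc _ = s≤s z≤n
          S-tight : outside S Z + Δ ≤ 0 + size S * s
          S-tight = ≤-trans (+-mono-≤ (outside-∷ S y Z) (≤-reflexive (sym (*-identityˡ Δ))))
            (cover-bound S [] (y ∷ Z) 1 cover (≤-reflexive (inside-[] S)) (≤-trans (≤-reflexive (sym (+-suc (length Z) 1))) short))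
          S+S′≤r : size S + size S′ ≤ 1 + 2 * h
          S+S′≤r = ≤-trans (≤-reflexive (+-comm (size S) _)) (≤-trans S′+S≤r (≤-reflexive r≡))
          S+S′-s : (size S + size S′) * s ≤ (1 + 2 * h) * s
          S+S′-s = *-monoˡ-≤ s S+S′≤r
          finish : ∀ Z′ → Configuration S′ Z′ u → leak S′ Z′ u + 2 * Δ ≤ (size S + size S′) * s → ⊥
          finish Z′ K′ two = k (S′ , Z′ , u , K′ , S′≤h , small , inj₂ c<S′)
            where
            small : leak S′ Z′ u < s
            small = +-cancelʳ-< (2 * Δ) _ _ (≤-<-trans (≤-trans two S+S′-s) (+-monoʳ-< s (cs<2Δ ≤-refl)))
            2h<S+S′ : 2 * h < size S + size S′
            2h<S+S′ = ≰⇒> λ le → <-irrefl refl (≤-<-trans (m+n≤o⇒n≤o (leak S′ Z′ u) two) (cs<2Δ le))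
            c<S′ : c < size S′
            c<S′ = +-cancelˡ-< (size S) c (size S′) (≤-<-trans S+c≤2h 2h<S+S′)
            S′≤h : size S′ ≤ h
            S′≤h = +-cancelˡ-≤ (1 + h) (size S′) h (begin
              1 + h + size S′  ≤⟨ +-monoˡ-≤ (size S′) h<S ⟩
              size S + size S′ ≤⟨ S+S′≤r ⟩
              1 + 2 * h        ≡⟨ cong (λ x → 1 + (h + x)) (+-identityʳ h) ⟩
              1 + h + h        ∎)
              where open ≤-Reasoning

      -- The at most 2|C| - 1 vertices of `x ∷ W` cannot dominate |C| ≤ h parts. In the step from
      -- `y`, the first alternative fails as 1 + |S| ≤ 2h. If |S| ≤ h, then |S|s < Δ lowers the
      -- leak, and Δ < (1 + |S|)s gives |C| ≤ |S|.
      next : ∀ {C W x} → Configuration C W x → size C ≤ h → leak C W x < s → ¬ ¬ Next (size C) (leak C W x)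
      next {C} {W} {x} K C≤h l<s k =
        undominated C (x ∷ W) 1 (≤-trans (≤-reflexive (sym (+-suc (length W) 1))) short)
          (≤-trans (cs<Δ C≤h) (≤-reflexive (sym (*-identityˡ Δ))))
          λ (y , y∈C , y≁) → step K y y∈C y≁ λ O →
            handle y (Outcome.S O) (room C x (Outcome.S O) x∉C (Outcome.bound O)) (Outcome.result O)
        where
        open Configuration K
        0<C : 0 < size C
        0<C with size C | short
        ... | zero  | le = contradiction (≤-trans (m≤n+m 2 (length W)) le) λ()
        ... | suc _ | _  = s≤s z≤n
        handle : ∀ y S → size S + size C ≤ 2 * h →
                 (2 * Δ ≤ leak C W x + size S * s) ⊎
                 (∃ λ Z → Configuration S Z y × leak S Z y + Δ ≤ leak C W x + size S * s) → ⊥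
        handle y S S+C≤2h (inj₁ le) = <-irrefl refl (begin-strict
          2 * Δ                   ≤⟨ le ⟩
          leak C W x + size S * s <⟨ l+cs<[1+c]s (size S) l<s ⟩
          (1 + size S) * s        <⟨ cs<2Δ (≤-trans (≤-trans (+-monoˡ-≤ (size S) 0<C) (≤-reflexive (+-comm (size C) _))) S+C≤2h) ⟩
          2 * Δ                   ∎)
          where open ≤-Reasoning
        handle y S S+C≤2h (inj₂ (Z , K′ , le)) with size S ≤? h
        ... | no  S≰h = from-large K′ (≰⇒> S≰h) S+C≤2h l<s le k
        ... | yes S≤h = k (S , Z , y , K′ , S≤h , <-trans smaller l<s , inj₁ (C≤S , smaller))
          where
          smaller : leak S Z y < leak C W x
          smaller = +-cancelʳ-< Δ _ _ (≤-<-trans le (+-monoʳ-< (leak C W x) (cs<Δ S≤h)))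
          C≤S : size C ≤ size S
          C≤S = ≮⇒≥ λ lt → <-irrefl refl (begin-strict
            Δ                       ≤⟨ m+n≤o⇒n≤o (leak S Z y) le ⟩
            leak C W x + size S * s <⟨ l+cs<[1+c]s (size S) l<s ⟩
            (1 + size S) * s        <⟨ cs<Δ (≤-trans lt C≤h) ⟩
            Δ                       ∎)
            where open ≤-Reasoning

      -- Lexicographic induction: `f` bounds h - |C| and `n` the leak. When |C| grows, `f` drops and
      -- the bound on the leak is reset to `s`.
      descent : ∀ f n {C W x} → Configuration C W x → size C ≤ h → h ≤ size C + f → leak C W x < s → leak C W x < n → ⊥
      descent f (suc n) {C} {W} {x} K C≤h h≤C+f l<s (s≤s l≤n) = next K C≤h l<s λ where
          (C′ , W′ , x′ , K′ , C′≤h , l′<s , inj₁ (C≤C′ , l′<l)) →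
            descent f n K′ C′≤h (≤-trans h≤C+f (+-monoˡ-≤ f C≤C′)) l′<s (≤-trans l′<l l≤n)
          (C′ , W′ , x′ , K′ , C′≤h , l′<s , inj₂ C<C′) → larger f h≤C+f K′ C′≤h l′<s C<C′
        where
        larger : ∀ f → h ≤ size C + f → ∀ {C′ W′ x′} → Configuration C′ W′ x′ → size C′ ≤ h → leak C′ W′ x′ < s →
                 size C < size C′ → ⊥
        larger zero    h≤C _ C′≤h _ C<C′ =
          <-irrefl refl (≤-trans (≤-<-trans (≤-trans h≤C (≤-reflexive (+-identityʳ _))) C<C′) C′≤h)
        larger (suc f) h≤ K′ C′≤h l′<s C<C′ =
          descent f s K′ C′≤h (≤-trans h≤ (≤-trans (≤-reflexive (+-suc _ f)) (+-monoˡ-≤ f C<C′))) l′<s l′<s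

      -- The sequence starts from a single vertex with leak 0. The first configuration has Δ ≤ |S|s
      -- and hence more than h parts, so `from-large` brings it back to at most h.
      contradictory : V → ⊥
      contradictory v = core ⁅ part v ⁆ ⁅ part v ⁆ v [] 0 π (⁅⁆⁺ _) (λ _ p → p) (≤-reflexive (outside-[] ⁅ part v ⁆)) λ O →
        start (Outcome.S O) (Outcome.bound O) (Outcome.result O)
        where
        π : Transversal part ⁅ part v ⁆ (_∈ v ∷ [])
        π = record { rep = λ _ → v ; rep-label = λ k k∈ → sym (⁅⁆⁻ k∈) ; rep-in = λ _ _ → here refl
                   ; independent = λ _ _ _ _ → e-irrefl v }
        start : ∀ S → size S + size ⁅ part v ⁆ ≤ r →
                (2 * Δ ≤ size S * s) ⊎ (∃ λ Z → Configuration S Z v × leak S Z v + Δ ≤ size S * s) → ⊥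
        start S bound = λ where
            (inj₁ le) → <-irrefl refl (≤-<-trans le (cs<2Δ S≤2h))
            (inj₂ (Z , K , le)) →
              let Δ≤Ss = m+n≤o⇒n≤o (leak S Z v) le
                  h<S = ≰⇒> λ S≤h → <-irrefl refl (≤-<-trans Δ≤Ss (cs<Δ S≤h))
                  0<s = n≢0⇒n>0 λ s≡0 → n≮0 (≤-trans hs<Δ (≤-trans Δ≤Ss (≤-reflexive (trans (cong (size S *_) s≡0) (*-zeroʳ (size S))))))
              in from-large {0} {0} K h<S (≤-trans (≤-reflexive (+-identityʳ _)) S≤2h) 0<s le λ where
                (C , W , x , K′ , C≤h , l<s , _) → descent h s K′ C≤h (m≤n+m h (size C)) l<s l<s
          where
          S≤2h : size S ≤ 2 * h
          S≤2h = ≤-pred (≤-trans (≤-trans (≤-reflexive (+-comm 1 (size S))) (+-monoʳ-≤ (size S) (0<size ⁅ part v ⁆ (part v) (⁅⁆⁺ _)))) (≤-trans bound (≤-reflexive r≡)))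

-- From colourings to blue graphs.

lookup-injective : ∀ {A : Set} {xs : List A} → Unique xs → ∀ i j → lookup xs i ≡ lookup xs j → i ≡ j
lookup-injective (_ ∷ _)      Fin.zero    Fin.zero    _  = refl
lookup-injective {xs = _ ∷ xs} (x∉ ∷ _) Fin.zero (Fin.suc j) eq = contradiction eq (All.lookup x∉ (∈-lookup {xs = xs} j))
lookup-injective {xs = _ ∷ xs} (x∉ ∷ _) (Fin.suc i) Fin.zero eq = contradiction (sym eq) (All.lookup x∉ (∈-lookup {xs = xs} i))
lookup-injective (_ ∷ u)      (Fin.suc i) (Fin.suc j) eq = cong Fin.suc (lookup-injective u i j eq)

any-Vec? : ∀ {t} n {P : Vec (Fin t) n → Set} → (∀ v → Dec (P v)) → Dec (∃ P)
any-Vec? zero    P? = map′ ([] ,_) (λ { ([] , p) → p }) (P? [])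
any-Vec? (suc n) P? = map′ (λ (a , v , p) → a ∷ v , p) (λ { (a ∷ v , p) → a , v , p })
                           (any? λ a → any-Vec? n λ v → P? (a ∷ v))

module BlueGraph {r t : ℕ} (c : Colouring r t) where

  isBlue : Colour → Bool
  isBlue red  = false
  isBlue blue = true

  -- The first factor discards the arbitrary colours of pairs inside a part, so that degrees count
  -- genuine edges.
  e : Vertex r t → Vertex r t → Bool
  e u v = not (does (proj₁ u Fin.≟ proj₁ v)) ∧ isBlue (col c u v)

  e-sym : ∀ u v → e u v ≡ e v u
  e-sym u v rewrite Colouring.sym c u v with proj₁ u Fin.≟ proj₁ v | proj₁ v Fin.≟ proj₁ u
  ... | yes _  | yes _  = refl
  ... | no  _  | no  _  = refl
  ... | yes eq | no  ne = contradiction (sym eq) ne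
  ... | no  ne | yes eq = contradiction (sym eq) ne

  e-irrefl : ∀ v → e v v ≡ false
  e-irrefl v with proj₁ v Fin.≟ proj₁ v
  ... | yes _  = refl
  ... | no  ne = contradiction refl ne

  e⇒blue : ∀ u v → e u v ≡ true → Adj u v × col c u v ≡ blue
  e⇒blue u v eq with proj₁ u Fin.≟ proj₁ v | col c u v
  ... | no ne | blue = ne , refl

  ¬e⇒red : ∀ u v → Adj u v → e u v ≡ false → col c u v ≡ red
  ¬e⇒red u v ne eq with proj₁ u Fin.≟ proj₁ v | col c u v
  ... | yes p | _   = contradiction p ne
  ... | no  _ | red = refl

  open Transversals r e e-sym e-irrefl

  neighbours : Vertex r t → ℕ
  neighbours w = total (cartesianProduct (allFin r) (allFin t)) (λ v → 𝟙 (e w v))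

  star : ∀ w n → n ≤ neighbours w → BlueStar c n
  star w n n≤ = w , (λ a → lookup L (inject≤ a n≤L)) ,
    (λ {a} {b} eq → inject≤-injective n≤L n≤L a b (lookup-injective unique _ _ eq)) ,
    (λ a → e⇒blue w _ (proj₂ (∈-filter⁻ (λ v → e w v Bool.≟ true) {xs = cartesianProduct (allFin r) (allFin t)} (∈-lookup {xs = L} (inject≤ a n≤L)))))
    where
    L : List (Vertex r t)
    L = filter (λ v → e w v Bool.≟ true) (cartesianProduct (allFin r) (allFin t))
    n≤L : n ≤ length L
    n≤L = ≤-trans n≤ (≤-reflexive (sym (length-filter (e w) (cartesianProduct (allFin r) (allFin t)))))
    unique : Unique L
    unique = filter⁺ (λ v → e w v Bool.≟ true) (cartesianProduct⁺ (allFin⁺ r) (allFin⁺ t))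

  Choice : Vec (Fin t) r → Set
  Choice v = ∀ k l → e (k , Vec.lookup v k) (l , Vec.lookup v l) ≡ false

  clique : ∃ Choice → RedClique c r
  clique (v , ind) = (λ k → k , Vec.lookup v k) , cong proj₁ , λ a b a≢b → a≢b , ¬e⇒red _ _ a≢b (ind a b)

  no-choice : ¬ ∃ Choice → ¬ Transversal proj₁ (λ _ → true) (λ _ → ⊤)
  no-choice none τ = none (Vec.tabulate (proj₂ ∘ rep τ) , λ k l →
    trans (cong₂ e (same k) (same l)) (independent τ k l refl refl))
    where
    same : ∀ k → (k , Vec.lookup (Vec.tabulate (proj₂ ∘ rep τ)) k) ≡ rep τ k
    same k = cong₂ _,_ (sym (rep-label τ k refl)) (Vec.lookup∘tabulate (proj₂ ∘ rep τ) k)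

  -- `Arrows` demands an actual clique or star, whereas the combinatorial argument ends in a
  -- contradiction. Both are therefore searched for among finitely many candidates, and only the
  -- failure of both searches has to be refuted.
  clique-or-star : ∀ Δ → ((∀ w → neighbours w ≤ Δ) → ¬ Transversal proj₁ (λ _ → true) (λ _ → ⊤) → ⊥) →
                   RedClique c r ⊎ BlueStar c (suc Δ)
  clique-or-star Δ absurd with any? (λ k → any? (λ x → suc Δ ≤? neighbours (k , x)))
  ... | yes (k , x , Δ<) = inj₂ (star (k , x) (suc Δ) Δ<)
  ... | no  small with any-Vec? r (λ v → all? λ k → all? λ l → e (k , Vec.lookup v k) (l , Vec.lookup v l) Bool.≟ false)
  ...   | yes ch = inj₁ (clique ch)
  ...   | no  none = ⊥-elim (absurd (λ (k , x) → ≮⇒≥ λ lt → small (k , x , lt)) (no-choice none))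

-- For r = 2h the hypothesis hs < Δ reads rs < 2Δ, against `haxell-bound`; for r = 2h + 1 the
-- descent applies.
arrows : ∀ h r t Δ s → 0 < h → r ≡ 2 * h ⊎ r ≡ 1 + 2 * h → 0 < t → t + s ≡ 2 * Δ → h * s < Δ → Arrows r (suc Δ) t
arrows h@(suc _) r (suc t) Δ s 0<h r≡ 0<t t+s hs<Δ c = clique-or-star Δ (absurd r≡)
  where
  open BlueGraph c
  v₀ : r ≡ 2 * h ⊎ r ≡ 1 + 2 * h → Vertex r (suc t)
  v₀ (inj₁ refl) = Fin.zero , Fin.zero
  v₀ (inj₂ refl) = Fin.zero , Fin.zero
  absurd : r ≡ 2 * h ⊎ r ≡ 1 + 2 * h → (∀ w → neighbours w ≤ Δ) →
           ¬ Transversals.Transversal r e e-sym e-irrefl proj₁ (λ _ → true) (λ _ → ⊤) → ⊥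
  absurd (inj₁ eq) deg noT = <-irrefl refl (≤-<-trans (haxell-bound (v₀ r≡)) (≤-<-trans
    (≤-reflexive (trans (cong (_* s) eq) (*-assoc 2 h s))) (*-monoʳ-< 2 hs<Δ)))
    where open Bounded.NoTransversal r (suc t) Δ s t+s e e-sym e-irrefl deg noT
  absurd (inj₂ eq) deg noT = contradictory (v₀ r≡)
    where open Bounded.NoTransversal.Odd r (suc t) Δ s t+s e e-sym e-irrefl deg noT h eq hs<Δ 0<h

-- The extremal colouring.

injective⇒surjective : ∀ {n} {f : Fin n → Fin n} → Injective _≡_ _≡_ f → ∀ y → ∃ λ x → f x ≡ y
injective⇒surjective {suc n} {f} inj y with any? (λ x → f x Fin.≟ y)
... | yes found = found
-- Punching out a missed value `y` leaves an injection into a smaller set.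
... | no  none  = contradiction
  (λ {a} {b} eq → inj (punchOut-injective (λ e → none (a , sym e)) (λ e → none (b , sym e)) eq))
  (<⇒notInjective {f = λ x → punchOut {i = y} {j = f x} (λ e → none (x , sym e))} (n<1+n n))

module Extremal (h t Δ s : ℕ) .{{_ : NonZero s}} (t+s≡2Δ : t + s ≡ 2 * Δ) (Δ≤ : Δ ≤ suc h * s) where

  -- The two halves of the construction consist of suc h parts each. In each half there are sets
  -- A₀ , … , A_h and B₀ , … , B_{h-1} of Δ vertices; A_k and B_k are joined completely for k < h,
  -- and so are the two sets A_h. Part 0 consists of A₀ and of s vertices of each A_k with k > 0,
  -- part i > 0 consists of B_{i-1} and the remaining Δ - s vertices of A_i. A set is encoded
  -- by (half , is it an A? , index).
  Class : Set
  Class = Bool × Bool × ℕ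

  _≟ᶜ_ : (c d : Maybe Class) → Dec (c ≡ d)
  _≟ᶜ_ = Maybe.≡-dec (Product.≡-dec Bool._≟_ (Product.≡-dec Bool._≟_ ℕ._≟_))

  -- The value at `nothing` is a default. Blue requires the classes to be opposite in both
  -- directions, and `nothing` is never a value, so a part outside the two halves has no blue edges.
  opposite : Maybe Class → Maybe Class
  opposite nothing              = just (false , true , 0)
  opposite (just (σ , false , k)) = just (σ , true , k)
  opposite (just (σ , true , k)) with k ℕ.≟ h
  ... | yes _ = just (not σ , true , k)
  ... | no  _ = just (σ , false , k)

  opposite-just : ∀ c → ∃ λ d → opposite c ≡ just d
  opposite-just nothing              = _ , refl
  opposite-just (just (σ , false , k)) = _ , refl
  opposite-just (just (σ , true , k)) with k ℕ.≟ h
  ... | yes _ = _ , refl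
  ... | no  _ = _ , refl

  slot : ℕ → ℕ → (Bool × ℕ) × ℕ
  slot zero x with x <? Δ
  ... | yes _ = (true , 0) , x
  -- In each A_k with k > 0, the indices below Δ - s belong to part k and the last s indices to part
  -- 0.
  ... | no  _ = (true , suc ((x ∸ Δ) / s)) , (Δ ∸ s) + (x ∸ Δ) % s
  slot (suc i) x with x <? Δ
  ... | yes _ = (false , i) , x
  ... | no  _ = (true , suc i) , x ∸ Δ

  -- Recovers the position from class and index, so that a class has no more vertices than indices.
  unslot : (Bool × ℕ) × ℕ → ℕ × ℕ
  unslot ((false , k)    , y) = suc k , y
  unslot ((true , zero)  , y) = 0 , y
  unslot ((true , suc k) , y) with y <? Δ ∸ s
  ... | yes _ = suc k , Δ + y
  ... | no  _ = 0 , Δ + ((y ∸ (Δ ∸ s)) + k * s)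

  private
    s<Δ : ∀ {x} → x < t → Δ ≤ x → s < Δ
    s<Δ x<t Δ≤x = linear 0 (+-mono-≤ (+-mono-≤ x<t Δ≤x) (≤-reflexive t+s≡2Δ)) (ring _ s t Δ)
      where
      ring : ∀ x s t Δ → 0 + suc s + (t + x + 2 * Δ) ≡ Δ + (suc x + Δ + (t + s))
      ring = solve-∀

    x∸Δ<Δ∸s : ∀ {x} → x < t → Δ ≤ x → x ∸ Δ < Δ ∸ s
    x∸Δ<Δ∸s {x} x<t Δ≤x = +-cancelʳ-< (Δ + s) _ _ (begin-strict
      x ∸ Δ + (Δ + s)   ≡⟨ +-assoc (x ∸ Δ) Δ s ⟨
      x ∸ Δ + Δ + s     ≡⟨ cong (_+ s) (m∸n+n≡m Δ≤x) ⟩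
      x + s             <⟨ +-monoˡ-< s x<t ⟩
      t + s             ≡⟨ t+s≡2Δ ⟩
      2 * Δ             ≡⟨ cong (Δ +_) (+-identityʳ Δ) ⟩
      Δ + Δ             ≡⟨ cong (_+ Δ) (m∸n+n≡m (<⇒≤ (s<Δ x<t Δ≤x))) ⟨
      Δ ∸ s + s + Δ     ≡⟨ +-assoc (Δ ∸ s) s Δ ⟩
      Δ ∸ s + (s + Δ)   ≡⟨ cong (Δ ∸ s +_) (+-comm s Δ) ⟩
      Δ ∸ s + (Δ + s)   ∎)
      where open ≤-Reasoning

  unslot-slot : ∀ i {x} → x < t → unslot (slot i x) ≡ (i , x)
  unslot-slot zero {x} x<t with x <? Δ
  ... | yes _ = refl
  ... | no x≮Δ with (Δ ∸ s) + (x ∸ Δ) % s <? Δ ∸ s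
  ...   | yes lt = contradiction lt (m+n≮m (Δ ∸ s) _)
  ...   | no  _  = cong (0 ,_) (begin
    Δ + (((Δ ∸ s) + (x ∸ Δ) % s ∸ (Δ ∸ s)) + (x ∸ Δ) / s * s)
      ≡⟨ cong (λ y → Δ + (y + (x ∸ Δ) / s * s)) (m+n∸m≡n (Δ ∸ s) ((x ∸ Δ) % s)) ⟩
    Δ + ((x ∸ Δ) % s + (x ∸ Δ) / s * s) ≡⟨ cong (Δ +_) (m≡m%n+[m/n]*n (x ∸ Δ) s) ⟨
    Δ + (x ∸ Δ)                         ≡⟨ m+[n∸m]≡n (≮⇒≥ x≮Δ) ⟩
    x                                   ∎)
    where open ≡-Reasoning
  unslot-slot (suc i) {x} x<t with x <? Δ
  ... | yes _ = refl
  ... | no x≮Δ with x ∸ Δ <? Δ ∸ s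
  ...   | yes _ = cong (suc i ,_) (m+[n∸m]≡n (≮⇒≥ x≮Δ))
  ...   | no ≮  = contradiction (x∸Δ<Δ∸s x<t (≮⇒≥ x≮Δ)) ≮

  slot-index<Δ : ∀ i {x} → x < t → proj₂ (slot i x) < Δ
  slot-index<Δ zero {x} x<t with x <? Δ
  ... | yes x<Δ = x<Δ
  ... | no  x≮Δ = ≤-trans (+-monoʳ-< (Δ ∸ s) (m%n<n (x ∸ Δ) s)) (≤-reflexive (m∸n+n≡m (<⇒≤ (s<Δ x<t (≮⇒≥ x≮Δ)))))
  slot-index<Δ (suc i) {x} x<t with x <? Δ
  ... | yes x<Δ = x<Δ
  ... | no  x≮Δ = ≤-trans (x∸Δ<Δ∸s x<t (≮⇒≥ x≮Δ)) (m∸n≤m Δ s)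

  -- By Δ ≤ (h + 1)s, part 0 has t - Δ = Δ - s ≤ hs vertices beyond A₀, so its blocks of s vertices
  -- only reach the indices 1 to h.
  slot≤h : ∀ i {x k} → i ≤ h → x < t → proj₁ (slot i x) ≡ (true , k) → k ≤ h
  slot≤h zero {x} _ x<t eq with x <? Δ | eq
  ... | yes _  | refl = z≤n
  ... | no x≮Δ | refl = m<n*o⇒m/o<n {x ∸ Δ} {h} {s} (+-cancelʳ-< Δ _ _ (≤-<-trans (≤-reflexive (m∸n+n≡m (≮⇒≥ x≮Δ)))
    (linear 0 (+-mono-≤ (+-mono-≤ x<t Δ≤) (≤-reflexive t+s≡2Δ)) (ring x t s Δ h))))
    where
    ring : ∀ x t s Δ h → 0 + suc x + (t + suc h * s + 2 * Δ) ≡ h * s + Δ + (suc x + Δ + (t + s))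
    ring = solve-∀
  slot≤h (suc i) {x} i≤h x<t eq with x <? Δ | eq
  ... | no _ | refl = i≤h

  climb : ∀ (f : ℕ → ℕ) → (∀ i → f i < t) →
          (∀ i j k → i ≤ h → j ≤ h → k < h → i ≢ j →
             proj₁ (slot i (f i)) ≡ (true , k) → proj₁ (slot j (f j)) ≢ (false , k)) →
          ∃ λ i → i ≤ h × proj₁ (slot i (f i)) ≡ (true , h)
  climb f f<t indep = top (reach h ≤-refl)
    where
    -- The parts 0 … m contain a vertex of some A_k with k ≥ m: if k = m, then part m + 1 cannot
    -- use B_m.
    reach : ∀ m → m ≤ h → ∃ λ i → ∃ λ k → i ≤ m × m ≤ k × proj₁ (slot i (f i)) ≡ (true , k)
    reach zero m≤h with f zero <? Δ in eq
    ... | yes _ = 0 , 0 , z≤n , z≤n , at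
      where
      at : proj₁ (slot 0 (f 0)) ≡ (true , 0)
      at rewrite eq = refl
    ... | no  _ = 0 , _ , z≤n , z≤n , at
      where
      at : proj₁ (slot 0 (f 0)) ≡ (true , suc ((f 0 ∸ Δ) / s))
      at rewrite eq = refl
    reach (suc m) m<h with reach m (<⇒≤ m<h)
    ... | i , k , i≤m , m≤k , at with m ℕ.≟ k
    ...   | no  m≢k  = i , k , m≤n⇒m≤1+n i≤m , ≤∧≢⇒< m≤k m≢k , at
    ...   | yes refl with f (suc m) <? Δ in eq
    ...     | yes _ = contradiction at′ (indep i (suc m) m (≤-trans i≤m (<⇒≤ m<h)) m<h m<h (<⇒≢ (s≤s i≤m)) at)
      where
      at′ : proj₁ (slot (suc m) (f (suc m))) ≡ (false , m)
      at′ rewrite eq = refl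
    ...     | no  _ = suc m , suc m , ≤-refl , ≤-refl , at′
      where
      at′ : proj₁ (slot (suc m) (f (suc m))) ≡ (true , suc m)
      at′ rewrite eq = refl
    top : (∃ λ i → ∃ λ k → i ≤ h × h ≤ k × proj₁ (slot i (f i)) ≡ (true , k)) →
          ∃ λ i → i ≤ h × proj₁ (slot i (f i)) ≡ (true , h)
    top (i , k , i≤h , h≤k , at) =
      i , i≤h , trans at (cong (true ,_) (≤-antisym (slot≤h i i≤h (f<t i) at) h≤k))

  locate : ℕ → Maybe (Bool × ℕ)
  locate p with p <? suc h
  ... | yes _ = just (false , p)
  ... | no  _ with p ∸ suc h <? suc h
  ...   | yes _ = just (true , p ∸ suc h)
  ...   | no  _ = nothing

  place : Bool → ℕ → ℕ
  place false i = i
  place true  i = i + suc h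

  place-locate : ∀ p {σ i} → locate p ≡ just (σ , i) → place σ i ≡ p
  place-locate p eq with p <? suc h
  place-locate p refl | yes _ = refl
  ... | no p≮ with p ∸ suc h <? suc h
  place-locate p refl | no p≮ | yes _ = m∸n+n≡m (≮⇒≥ p≮)

  locate-place : ∀ σ {i} → i ≤ h → locate (place σ i) ≡ just (σ , i)
  locate-place false {i} i≤h with i <? suc h
  ... | yes _ = refl
  ... | no ≮  = contradiction (s≤s i≤h) ≮
  locate-place true {i} i≤h with i + suc h <? suc h
  ... | yes lt = contradiction lt (m+n≮n i (suc h))
  ... | no _ with i + suc h ∸ suc h <? suc h
  ...   | yes _ = cong (λ m → just (true , m)) (m+n∸n≡m i (suc h))
  ...   | no ≮  = contradiction (s≤s (≤-trans (≤-reflexive (m+n∸n≡m i (suc h))) i≤h)) ≮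

  code : ℕ → ℕ → Maybe (Class × ℕ)
  code p x with locate p
  ... | nothing      = nothing
  ... | just (σ , i) = just ((σ , proj₁ (slot i x)) , proj₂ (slot i x))

  decode : Class × ℕ → ℕ × ℕ
  decode ((σ , c) , y) = place σ (proj₁ (unslot (c , y))) , proj₂ (unslot (c , y))

  decode-code : ∀ p {x cy} → x < t → code p x ≡ just cy → decode cy ≡ (p , x)
  decode-code p {x} x<t eq with locate p in at
  decode-code p {x} x<t refl | just (σ , i) rewrite unslot-slot i x<t = cong (_, x) (place-locate p at)

  code-index<Δ : ∀ p {x cy} → x < t → code p x ≡ just cy → proj₂ cy < Δ
  code-index<Δ p {x} x<t eq with locate p
  code-index<Δ p {x} x<t refl | just (σ , i) = slot-index<Δ i x<t

  module _ (r : ℕ) where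

    class : Vertex r t → Maybe Class
    class (p , x) = Maybe.map proj₁ (code (toℕ p) (toℕ x))

    class-code : ∀ p x {c} → class (p , x) ≡ just c → ∃ λ y → code (toℕ p) (toℕ x) ≡ just (c , y)
    class-code p x eq with code (toℕ p) (toℕ x)
    class-code p x refl | just (c , y) = y , refl

    joined : Vertex r t → Vertex r t → Colour
    joined u v with class u ≟ᶜ opposite (class v) | class v ≟ᶜ opposite (class u)
    ... | yes _ | yes _ = blue
    ... | yes _ | no  _ = red
    ... | no  _ | _     = red

    joined⇒ : ∀ u v → joined u v ≡ blue → class v ≡ opposite (class u)
    joined⇒ u v eq with class u ≟ᶜ opposite (class v) | class v ≟ᶜ opposite (class u)
    ... | yes _ | yes q = q

    ⇒joined : ∀ u v → class u ≡ opposite (class v) → class v ≡ opposite (class u) → joined u v ≢ red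
    ⇒joined u v p q eq with class u ≟ᶜ opposite (class v) | class v ≟ᶜ opposite (class u)
    ... | yes _ | no ¬q = ¬q q
    ... | no ¬p | _     = ¬p p

    joined-sym : ∀ u v → joined u v ≡ joined v u
    joined-sym u v with class u ≟ᶜ opposite (class v) | class v ≟ᶜ opposite (class u)
    ... | yes _ | yes _ = refl
    ... | yes _ | no  _ = refl
    ... | no  _ | yes _ = refl
    ... | no  _ | no  _ = refl

    colouring : Colouring r t
    colouring = record { col = joined ; sym = joined-sym }

    -- All blue neighbours of `v` lie in the class opposite to its own, which has only Δ indices.
    no-star : ¬ BlueStar colouring (suc Δ)
    no-star (v , g , g-inj , g-blue) = collide (pigeonhole (n<1+n Δ) (λ a → fromℕ< (index<Δ a)))
      where
      c : Class
      c = proj₁ (opposite-just (class v))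
      coded : ∀ a → ∃ λ y → code (toℕ (proj₁ (g a))) (toℕ (proj₂ (g a))) ≡ just (c , y)
      coded a = class-code (proj₁ (g a)) (proj₂ (g a)) (trans (joined⇒ v (g a) (proj₂ (g-blue a))) (proj₂ (opposite-just (class v))))
      index<Δ : ∀ a → proj₁ (coded a) < Δ
      index<Δ a = code-index<Δ (toℕ (proj₁ (g a))) (toℕ<n (proj₂ (g a))) (proj₂ (coded a))
      decoded : ∀ a → decode (c , proj₁ (coded a)) ≡ (toℕ (proj₁ (g a)) , toℕ (proj₂ (g a)))
      decoded a = decode-code (toℕ (proj₁ (g a))) (toℕ<n (proj₂ (g a))) (proj₂ (coded a))
      collide : (∃ λ a → ∃ λ b → a Fin.< b × fromℕ< (index<Δ a) ≡ fromℕ< (index<Δ b)) → ⊥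
      collide (a , b , a<b , eq) = <-irrefl (cong toℕ (g-inj ga≡gb)) a<b
        where
        same : (toℕ (proj₁ (g a)) , toℕ (proj₂ (g a))) ≡ (toℕ (proj₁ (g b)) , toℕ (proj₂ (g b)))
        same = trans (sym (decoded a)) (trans (cong (λ y → decode (c , y)) (fromℕ<-injective _ _ (index<Δ a) (index<Δ b) eq)) (decoded b))
        ga≡gb : g a ≡ g b
        ga≡gb = cong₂ _,_ (toℕ-injective (cong proj₁ same)) (toℕ-injective (cong proj₂ same))

    -- A red clique on r vertices meets every part. By `climb` it contains a vertex of A_h in each
    -- half, and these two are joined in blue.
    no-clique : suc h + suc h ≤ r → ¬ RedClique colouring r
    no-clique 2h≤r (f , f-inj , f-red) = meet (half false) (half true)
      where
      parts-injective : Injective _≡_ _≡_ (proj₁ ∘ f)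
      parts-injective {a} {b} eq with a Fin.≟ b
      ... | yes a≡b = a≡b
      ... | no  a≢b = contradiction eq (proj₁ (f-red a b a≢b))
      -- Capping at `h` makes `pick` total without affecting the indices i ≤ h.
      place<r : ∀ σ i → place σ (i ⊓ h) < r
      place<r σ i = ≤-trans (bound σ) 2h≤r
        where
        bound : ∀ σ → place σ (i ⊓ h) < suc h + suc h
        bound false = ≤-trans (s≤s (m⊓n≤n i h)) (m≤m+n (suc h) (suc h))
        bound true  = +-monoˡ-< (suc h) (s≤s (m⊓n≤n i h))
      pick : Bool → ℕ → Fin r
      pick σ i = proj₁ (injective⇒surjective parts-injective (fromℕ< (place<r σ i)))
      pick-part : ∀ σ i → i ≤ h → toℕ (proj₁ (f (pick σ i))) ≡ place σ i
      pick-part σ i i≤h = trans (cong toℕ (proj₂ (injective⇒surjective parts-injective (fromℕ< (place<r σ i)))))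
        (trans (toℕ-fromℕ< (place<r σ i)) (cong (place σ) (m≤n⇒m⊓n≡m i≤h)))
      pick-class : ∀ σ i → i ≤ h → class (f (pick σ i)) ≡ just (σ , proj₁ (slot i (toℕ (proj₂ (f (pick σ i))))))
      pick-class σ i i≤h rewrite pick-part σ i i≤h | locate-place σ i≤h = refl
      pick-distinct : ∀ σ τ i j → i ≤ h → j ≤ h → (σ , i) ≢ (τ , j) → pick σ i ≢ pick τ j
      pick-distinct σ τ i j i≤h j≤h ne eq = ne (just-injective (begin
        just (σ , i)                               ≡⟨ locate-place σ i≤h ⟨
        locate (place σ i)                         ≡⟨ cong locate (pick-part σ i i≤h) ⟨
        locate (toℕ (proj₁ (f (pick σ i))))        ≡⟨ cong (λ a → locate (toℕ (proj₁ (f a)))) eq ⟩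
        locate (toℕ (proj₁ (f (pick τ j))))        ≡⟨ cong locate (pick-part τ j j≤h) ⟩
        locate (place τ j)                         ≡⟨ locate-place τ j≤h ⟩
        just (τ , j)                               ∎))
        where open ≡-Reasoning
      clash : ∀ σ τ i j → i ≤ h → j ≤ h → (σ , i) ≢ (τ , j) →
              ∀ {c d} → class (f (pick σ i)) ≡ just c → class (f (pick τ j)) ≡ just d →
              just c ≡ opposite (just d) → just d ≡ opposite (just c) → ⊥
      clash σ τ i j i≤h j≤h ne u≡ v≡ p q = ⇒joined (f (pick σ i)) (f (pick τ j))
        (trans u≡ (trans p (cong opposite (sym v≡)))) (trans v≡ (trans q (cong opposite (sym u≡))))
        (proj₂ (f-red _ _ (pick-distinct σ τ i j i≤h j≤h ne)))
      half : ∀ σ → ∃ λ i → i ≤ h × proj₁ (slot i (toℕ (proj₂ (f (pick σ i))))) ≡ (true , h)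
      half σ = climb (λ i → toℕ (proj₂ (f (pick σ i)))) (λ i → toℕ<n _) λ i j k i≤h j≤h k<h i≢j at at′ →
        clash σ σ i j i≤h j≤h (i≢j ∘ cong proj₂)
          (trans (pick-class σ i i≤h) (cong (λ c → just (σ , c)) at))
          (trans (pick-class σ j j≤h) (cong (λ c → just (σ , c)) at′))
          refl (sym (opposite-A σ k<h))
        where
        opposite-A : ∀ σ {k} → k < h → opposite (just (σ , true , k)) ≡ just (σ , false , k)
        opposite-A σ {k} k<h with k ℕ.≟ h
        ... | yes k≡h = contradiction k≡h (<⇒≢ k<h)
        ... | no  _   = refl
      opposite-h : ∀ σ → opposite (just (σ , true , h)) ≡ just (not σ , true , h)
      opposite-h σ with h ℕ.≟ h
      ... | yes _   = refl
      ... | no  h≢h = contradiction refl h≢h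
      A-h : Bool → Set
      A-h σ = ∃ λ i → i ≤ h × proj₁ (slot i (toℕ (proj₂ (f (pick σ i))))) ≡ (true , h)
      meet : A-h false → A-h true → ⊥
      meet (i , i≤h , at) (j , j≤h , at′) = clash false true i j i≤h j≤h (λ ())
        (trans (pick-class false i i≤h) (cong (λ c → just (false , c)) at))
        (trans (pick-class true j j≤h) (cong (λ c → just (true , c)) at′))
        (sym (opposite-h true)) (sym (opposite-h false))

¬arrows : ∀ h r t Δ s → 0 < Δ → suc h + suc h ≤ r → t + s ≡ 2 * Δ → Δ ≤ suc h * s → ¬ Arrows r (suc Δ) t
¬arrows h r t Δ zero    0<Δ _ _ Δ≤ _ = n≮0 (≤-trans 0<Δ (≤-trans Δ≤ (≤-reflexive (*-zeroʳ (suc h)))))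
¬arrows h r t Δ (suc s) 0<Δ 2h≤r t+s Δ≤ arr with arr (Extremal.colouring h t Δ (suc s) t+s Δ≤ r)
... | inj₁ clique = Extremal.no-clique h t Δ (suc s) t+s Δ≤ r 2h≤r clique
... | inj₂ star   = Extremal.no-star h t Δ (suc s) t+s Δ≤ r star

-- From the threshold to the floor formulas.

floor-spec : ∀ a d → 0 < d → ⌊ a / d ⌋ * d ≤ a × a < (⌊ a / d ⌋ + 1) * d
floor-spec a (suc d) _ = m/n*n≤m a (suc d) , (begin-strict
  a                                   ≡⟨ m≡m%n+[m/n]*n a (suc d) ⟩
  a % suc d + a / suc d * suc d       <⟨ +-monoˡ-< (a / suc d * suc d) (m%n<n a (suc d)) ⟩
  (1 + a / suc d) * suc d             ≡⟨ cong (_* suc d) (+-comm 1 (a / suc d)) ⟩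
  (a / suc d + 1) * suc d             ∎)
  where open ≤-Reasoning

-- The two bounds on `N` make N + 1 the least t with (h + 1)(2Δ - t) < Δ, which is the threshold
-- between `arrows` and `¬arrows`.
size-multipartite : ∀ h r Δ N → r ≡ 2 * suc h ⊎ r ≡ 1 + 2 * suc h → 0 < Δ →
                    N * (2 * suc h) ≤ 2 * Δ * (1 + 2 * h) → 2 * Δ * (1 + 2 * h) < (N + 1) * (2 * suc h) →
                    IsSizeMRN r (suc Δ) (N + 1)
size-multipartite h r Δ N r≡ 0<Δ N≤ N+1> =
  arrows (suc h) r (N + 1) Δ (2 * Δ ∸ (N + 1)) (s≤s z≤n) r≡ (≤-trans (s≤s z≤n) (≤-reflexive (+-comm 1 N))) t+s hs<Δ ,
  λ t t<N+1 → let t≤N = ≤-pred (≤-trans t<N+1 (≤-reflexive (+-comm N 1)))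
                  t+s = m+[n∸m]≡n {t} {2 * Δ} (≤-trans t≤N N≤2Δ)
              in ¬arrows h r t Δ (2 * Δ ∸ t) 0<Δ 2h≤r t+s (Δ≤ t _ t≤N t+s)
  where
  N+1≤2Δ : N + 1 ≤ 2 * Δ
  N+1≤2Δ = ≤-trans (≤-reflexive (+-comm N 1)) (*-cancelʳ-< (2 * suc h) N (2 * Δ) (≤-<-trans N≤
    (*-monoʳ-< (2 * Δ) {{>-nonZero (≤-trans 0<Δ (m≤m+n Δ _))}} (≤-reflexive (ring h)))))
    where
    ring : ∀ h → suc (1 + 2 * h) ≡ 2 * suc h
    ring = solve-∀
  N≤2Δ : N ≤ 2 * Δ
  N≤2Δ = ≤-trans (m≤m+n N 1) N+1≤2Δ
  t+s : N + 1 + (2 * Δ ∸ (N + 1)) ≡ 2 * Δ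
  t+s = m+[n∸m]≡n N+1≤2Δ
  -- Both sides equal 2Δ · 2(h + 1). Hence comparing 2(h + 1)t with 2Δ(2h + 1) amounts to comparing
  -- Δ with (h + 1)s.
  balance : ∀ t s → t + s ≡ 2 * Δ → 2 * Δ * (1 + 2 * h) + 2 * Δ ≡ t * (2 * suc h) + 2 * (suc h * s)
  balance t s eq = trans (ring₁ Δ h) (trans (cong (_* (2 * suc h)) (sym eq)) (ring₂ t s h))
    where
    ring₁ : ∀ Δ h → 2 * Δ * (1 + 2 * h) + 2 * Δ ≡ 2 * Δ * (2 * suc h)
    ring₁ = solve-∀
    ring₂ : ∀ t s h → (t + s) * (2 * suc h) ≡ t * (2 * suc h) + 2 * (suc h * s)
    ring₂ = solve-∀
  hs<Δ : suc h * (2 * Δ ∸ (N + 1)) < Δ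
  hs<Δ = *-cancelˡ-< 2 _ Δ (+-cancelˡ-< (2 * Δ * (1 + 2 * h)) _ _
    (<-≤-trans (+-monoˡ-< _ N+1>) (≤-reflexive (sym (balance (N + 1) _ t+s)))))
  Δ≤ : ∀ t s → t ≤ N → t + s ≡ 2 * Δ → Δ ≤ suc h * s
  Δ≤ t s t≤N eq = *-cancelˡ-≤ 2 (+-cancelˡ-≤ (2 * Δ * (1 + 2 * h)) _ _
    (≤-trans (≤-reflexive (balance t s eq)) (+-monoˡ-≤ _ (≤-trans (*-monoˡ-≤ (2 * suc h) t≤N) N≤))))
  2h≤r : suc h + suc h ≤ r
  2h≤r = ≤-trans (≤-reflexive (cong (suc h +_) (sym (+-identityʳ (suc h))))) (bound r≡)
    where
    bound : r ≡ 2 * suc h ⊎ r ≡ 1 + 2 * suc h → 2 * suc h ≤ r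
    bound (inj₁ eq) = ≤-reflexive (sym eq)
    bound (inj₂ eq) = ≤-trans (n≤1+n _) (≤-reflexive (sym eq))

-- `d` is the largest even number up to `r`: the value for odd `r` is the one for r - 1 parts.
size-floor : ∀ h r Δ d → r ≡ d ⊎ r ≡ 1 + d → d ≡ 2 * suc h → 0 < Δ →
             IsSizeMRN r (suc Δ) (⌊ 2 * Δ * (d ∸ 1) / d ⌋ + 1)
size-floor h r Δ d r≡ refl 0<Δ =
  size-multipartite h r Δ _ r≡ 0<Δ
    (≤-trans (proj₁ spec) (≤-reflexive (cong (2 * Δ *_) pred-d))) (≤-<-trans (≤-reflexive (cong (2 * Δ *_) (sym pred-d))) (proj₂ spec))
  where
  spec : _
  spec = floor-spec (2 * Δ * (2 * suc h ∸ 1)) (2 * suc h) (s≤s z≤n)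
  pred-d : 2 * suc h ∸ 1 ≡ 1 + 2 * h
  pred-d = +-suc h (h + 0)

¬2∣⇒odd : ∀ j → ¬ 2 ∣ j → ∃ λ h → j ≡ 1 + 2 * h
¬2∣⇒odd j odd with j % 2 in eq | m%n<n j 2
... | zero        | _ = contradiction (m%n≡0⇒n∣m j 2 eq) odd
... | suc zero    | _ = j / 2 , trans (m≡m%n+[m/n]*n j 2) (cong₂ _+_ eq (*-comm (j / 2) 2))
... | suc (suc _) | s≤s (s≤s ())

theorem5 : (n j : ℕ) → 2 ≤ n → 2 ≤ j →
    (2 ∣ j → IsSizeMRN j n (⌊ 2 * (n ∸ 1) * (j ∸ 1) / j ⌋ + 1)) ×
    (¬ 2 ∣ j → IsSizeMRN j n (⌊ 2 * (n ∸ 1) * (j ∸ 2) / (j ∸ 1) ⌋ + 1))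
theorem5 (suc Δ) j (s≤s 0<Δ) 2≤j = even , odd
  where
  even : 2 ∣ j → IsSizeMRN j (suc Δ) (⌊ 2 * Δ * (j ∸ 1) / j ⌋ + 1)
  even (divides zero    refl) = contradiction 2≤j λ()
  even (divides (suc h) j≡)   = size-floor h j Δ j (inj₁ refl) (trans j≡ (*-comm (suc h) 2)) 0<Δ
  odd : ¬ 2 ∣ j → IsSizeMRN j (suc Δ) (⌊ 2 * Δ * (j ∸ 2) / (j ∸ 1) ⌋ + 1)
  odd ¬2∣j with ¬2∣⇒odd j ¬2∣j
  ... | zero  , refl = contradiction 2≤j λ { (s≤s ()) }
  ... | suc h , refl = size-floor h j Δ (2 * suc h) (inj₂ refl) refl 0<Δ
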